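{- Let $G$ be a TDAG. The following conditions are equivalent: (1) $G$ is a directed series-parallel graph; (2) the directed Braess graph $G_B$ is not d-embedded in $G$; (3) $SPW(G)=1$.
   Context: A 2-terminal directed graph $G=\langle V,E,s,t\rangle$ is a directed multigraph without self-loops with distinguished vertices $s,t$ such that every vertex and edge lies on at least one simple directed $s$–$t$ path; a TDAG is such a graph with no directed cycle. A directed series-parallel graph is a 2-terminal directed graph that is either a single edge $(s,t)$, or obtained from two directed series-parallel graphs $\langle V_1,E_1,s_1,t_1\rangle,\langle V_2,E_2,s_2,t_2\rangle$ by serial composition (identify $t_1$ with $s_2$; terminals $s_1,t_2$) or parallel composition (identify $s_1$ with $s_2$ and $t_1$ with $t_2$). The Braess graph $G_B$ has vertices $s,a,b,t$ and edges $(s,a),(s,b),(a,b),(a,t),(b,t)$. d-embeddings: $G'$ is d-embedded in $G$ if $G$ is isomorphic to a graph obtained from $G'$ by a finite (possibly empty) sequence of: (Addition) add a new edge $(a,b)$ between existing vertices with no directed path from $b$ to $a$; (Forward split) replace a vertex $a\neq t$ by vertices $a,b$ and a new edge $(a,b)$, $a$ retaining all incoming edges and the outgoing edges being distributed between $a$ and $b$ with $b$ retaining at least one; (Backward split) replace a vertex $b\neq s$ by vertices $a,b$ and a new edge $(a,b)$, $b$ retaining all outgoing edges and the incoming edges being distributed with $a$ retaining at least one. Cuts and widths: a cut is $C\subseteq E$ such that no directed $s$–$t$ path uses only edges of $E\setminus C$; minimal if no proper subset is a cut. $S\subseteq E$ is parallel if contained in a minimal cut, serial if contained in a simple directed $s$–$t$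 path. $SPW(G)$ is the maximum size of a set that is both serial and parallel. -}

module Defs where

open import Data.Nat using (ℕ; zero; suc; _≤_)
open import Data.Fin using (Fin; zero; suc)
open import Data.Fin.Subset using (Subset; _∈_; _∉_; _⊆_; ∣_∣)
open import Data.Bool using (Bool; true; false; if_then_else_)
open import Data.List using (List; []; _∷_)
import Data.List.Membership.Propositional as LM
open import Data.List.Relation.Unary.All using (All)
open import Data.List.Relation.Unary.Unique.Propositional using (Unique)
open import Data.Product using (Σ; Σ-syntax; ∃; ∃-syntax; _×_; _,_)
open import Data.Sum using (_⊎_)
open import Relation.Nullary using (¬_)
open import Relation.Binary.PropositionalEquality using (_≡_; _≢_)
open import Relation.Binary.Construct.Closure.ReflexiveTransitive using (Star)
open import Function.Definitions using (Injective; Bijective)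

record Graph : Set where
  field
    nV  : ℕ
    nE  : ℕ
    src : Fin nE → Fin nV
    tgt : Fin nE → Fin nV
    s   : Fin nV
    t   : Fin nV

open Graph public

data Path (G : Graph) : Fin (nV G) → Fin (nV G) → Set where
  []  : ∀ {u} → Path G u u
  _∷_ : ∀ {u v} (e : Fin (nE G)) → src G e ≡ u × Path G (tgt G e) v → Path G u v

edgesOf : ∀ {G u v} → Path G u v → List (Fin (nE G))
edgesOf []             = []
edgesOf (e ∷ (_ , p))  = e ∷ edgesOf p

verticesOf : ∀ {G u v} → Path G u v → List (Fin (nV G))
verticesOf {u = u} []      = u ∷ []
verticesOf {u = u} (e ∷ (_ , p)) = u ∷ verticesOf p

Simple : ∀ {G u v} → Path G u v → Set
Simple p = Unique (verticesOf p)

Reach : (G : Graph) → Fin (nV G) → Fin (nV G) → Set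
Reach G u v = Path G u v

TwoTerminal : Graph → Set
TwoTerminal G =
  (s G ≢ t G) ×
  (∀ e → src G e ≢ tgt G e) ×
  (∀ v → Σ[ p ∈ Path G (s G) (t G) ] Simple p × v LM.∈ verticesOf p) ×
  (∀ e → Σ[ p ∈ Path G (s G) (t G) ] Simple p × e LM.∈ edgesOf p)

Acyclic : Graph → Set
Acyclic G = ∀ v (p : Path G v v) → edgesOf p ≡ []

TDAG : Graph → Set
TDAG G = TwoTerminal G × Acyclic G

record Iso (G H : Graph) : Set where
  field
    fV    : Fin (nV G) → Fin (nV H)
    fE    : Fin (nE G) → Fin (nE H)
    fV-bij : Bijective _≡_ _≡_ fV
    fE-bij : Bijective _≡_ _≡_ fE
    src-hom : ∀ e → src H (fE e) ≡ fV (src G e)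
    tgt-hom : ∀ e → tgt H (fE e) ≡ fV (tgt G e)
    s-hom : fV (s G) ≡ s H
    t-hom : fV (t G) ≡ t H

-- Directed series-parallel graphs.
-- Compositions are described up to isomorphism: G is a serial (parallel)
-- composition of G₁ and G₂ if G is the disjoint union of (copies of) G₁ and
-- G₂ with exactly the prescribed vertices identified.

record Embedding2 (G₁ G₂ G : Graph) : Set where
  field
    fV₁ : Fin (nV G₁) → Fin (nV G)
    fV₂ : Fin (nV G₂) → Fin (nV G)
    fE₁ : Fin (nE G₁) → Fin (nE G)
    fE₂ : Fin (nE G₂) → Fin (nE G)
    fV₁-inj : Injective _≡_ _≡_ fV₁
    fV₂-inj : Injective _≡_ _≡_ fV₂
    fE₁-inj : Injective _≡_ _≡_ fE₁
    fE₂-inj : Injective _≡_ _≡_ fE₂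
    src₁ : ∀ e → src G (fE₁ e) ≡ fV₁ (src G₁ e)
    tgt₁ : ∀ e → tgt G (fE₁ e) ≡ fV₁ (tgt G₁ e)
    src₂ : ∀ e → src G (fE₂ e) ≡ fV₂ (src G₂ e)
    tgt₂ : ∀ e → tgt G (fE₂ e) ≡ fV₂ (tgt G₂ e)
    V-cover : ∀ v → (∃[ v₁ ] fV₁ v₁ ≡ v) ⊎ (∃[ v₂ ] fV₂ v₂ ≡ v)
    E-cover : ∀ e → (∃[ e₁ ] fE₁ e₁ ≡ e) ⊎ (∃[ e₂ ] fE₂ e₂ ≡ e)
    E-disj  : ∀ e₁ e₂ → fE₁ e₁ ≢ fE₂ e₂

open Embedding2 public

record SerialComp (G₁ G₂ G : Graph) : Set where
  field
    emb : Embedding2 G₁ G₂ G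
    glue : ∀ v₁ v₂ → (fV₁ emb v₁ ≡ fV₂ emb v₂) → (v₁ ≡ t G₁ × v₂ ≡ s G₂)
    glued : fV₁ emb (t G₁) ≡ fV₂ emb (s G₂)
    s-is : s G ≡ fV₁ emb (s G₁)
    t-is : t G ≡ fV₂ emb (t G₂)

record ParallelComp (G₁ G₂ G : Graph) : Set where
  field
    emb : Embedding2 G₁ G₂ G
    glue : ∀ v₁ v₂ → (fV₁ emb v₁ ≡ fV₂ emb v₂) →
           (v₁ ≡ s G₁ × v₂ ≡ s G₂) ⊎ (v₁ ≡ t G₁ × v₂ ≡ t G₂)
    glued-s : fV₁ emb (s G₁) ≡ fV₂ emb (s G₂)
    glued-t : fV₁ emb (t G₁) ≡ fV₂ emb (t G₂)
    s-is : s G ≡ fV₁ emb (s G₁)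
    t-is : t G ≡ fV₁ emb (t G₁)

K₂ : Graph
K₂ = record { nV = 2 ; nE = 1 ; src = λ _ → zero ; tgt = λ _ → suc zero
            ; s = zero ; t = suc zero }

data IsSP : Graph → Set where
  single   : ∀ {G} → Iso K₂ G → IsSP G
  serial   : ∀ {G₁ G₂ G} → IsSP G₁ → IsSP G₂ → SerialComp G₁ G₂ G → IsSP G
  parallel : ∀ {G₁ G₂ G} → IsSP G₁ → IsSP G₂ → ParallelComp G₁ G₂ G → IsSP G

-- The Braess graph: s = 0, a = 1, b = 2, t = 3;
-- edges (s,a), (s,b), (a,b), (a,t), (b,t).

braessSrc : Fin 5 → Fin 4
braessSrc zero                            = zero
braessSrc (suc zero)                      = zero
braessSrc (suc (suc zero))                = suc zero
braessSrc (suc (suc (suc zero)))          = suc zero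
braessSrc (suc (suc (suc (suc zero))))    = suc (suc zero)

braessTgt : Fin 5 → Fin 4
braessTgt zero                            = suc zero
braessTgt (suc zero)                      = suc (suc zero)
braessTgt (suc (suc zero))                = suc (suc zero)
braessTgt (suc (suc (suc zero)))          = suc (suc (suc zero))
braessTgt (suc (suc (suc (suc zero))))    = suc (suc (suc zero))

Braess : Graph
Braess = record { nV = 4 ; nE = 5 ; src = braessSrc ; tgt = braessTgt
                ; s = zero ; t = suc (suc (suc zero)) }

-- d-embedding operations.  In each result the new edge is edge `zero`
-- (old edges are shifted by `suc`); in the splits the new vertex is vertex
-- `zero` (old vertices shifted by `suc`).

addEdge : (G : Graph) → Fin (nV G) → Fin (nV G) → Graph
addEdge G a b = record
  { nV = nV G ; nE = suc (nE G)
  ; src = λ { zero → a ; (suc e) → src G e }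
  ; tgt = λ { zero → b ; (suc e) → tgt G e }
  ; s = s G ; t = t G }

fwdSplit : (G : Graph) → Fin (nV G) → (Fin (nE G) → Bool) → Graph
fwdSplit G a mv = record
  { nV = suc (nV G) ; nE = suc (nE G)
  ; src = λ { zero → suc a ; (suc e) → if mv e then zero else suc (src G e) }
  ; tgt = λ { zero → zero  ; (suc e) → suc (tgt G e) }
  ; s = suc (s G) ; t = suc (t G) }

bwdSplit : (G : Graph) → Fin (nV G) → (Fin (nE G) → Bool) → Graph
bwdSplit G b mv = record
  { nV = suc (nV G) ; nE = suc (nE G)
  ; src = λ { zero → zero  ; (suc e) → suc (src G e) }
  ; tgt = λ { zero → suc b ; (suc e) → if mv e then zero else suc (tgt G e) }
  ; s = suc (s G) ; t = suc (t G) }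

data Step : Graph → Graph → Set where
  addition : ∀ G a b → ¬ Reach G b a → Step G (addEdge G a b)
  fsplit   : ∀ G a (mv : Fin (nE G) → Bool) → a ≢ t G →
             (∀ e → mv e ≡ true → src G e ≡ a) →
             (∃[ e ] mv e ≡ true) →
             Step G (fwdSplit G a mv)
  bsplit   : ∀ G b (mv : Fin (nE G) → Bool) → b ≢ s G →
             (∀ e → mv e ≡ true → tgt G e ≡ b) →
             (∃[ e ] mv e ≡ true) →
             Step G (bwdSplit G b mv)

DEmbedded : Graph → Graph → Set
DEmbedded G' G = Σ[ H ∈ Graph ] Star Step G' H × Iso H G

IsCut : (G : Graph) → Subset (nE G) → Set
IsCut G C = ∀ (p : Path G (s G) (t G)) → ¬ All (λ e → e ∉ C) (edgesOf p)

IsMinimalCut : (G : Graph) → Subset (nE G) → Set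
IsMinimalCut G C = IsCut G C × (∀ C' → C' ⊆ C → IsCut G C' → C ⊆ C')

IsParallel : (G : Graph) → Subset (nE G) → Set
IsParallel G S = ∃[ C ] IsMinimalCut G C × S ⊆ C

IsSerial : (G : Graph) → Subset (nE G) → Set
IsSerial G S = Σ[ p ∈ Path G (s G) (t G) ] Simple p × (∀ e → e ∈ S → e LM.∈ edgesOf p)

SPW≡ : Graph → ℕ → Set
SPW≡ G k =
  (Σ[ S ∈ Subset (nE G) ] IsSerial G S × IsParallel G S × ∣ S ∣ ≡ k) ×
  (∀ S → IsSerial G S → IsParallel G S → ∣ S ∣ ≤ k)

{-# OPTIONS --safe #-}
module Submission where

-- All three conditions are compared with the absence of a bridge: vertices a, b
-- with disjoint paths s → b and a → t and a path a → b. Bridges survive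
-- d-embedding steps, and series and parallel compositions create none. For a
-- bridge, let X be the set of vertices reachable from s off the path a → t; an
-- s–a–b–t path leaves X twice through the minimal cut δ(X), so SPW ≥ 2.
-- Conversely, two edges e before f in a minimal cut on one path give a bridge
-- from the end of e to the start of f.
--
-- A bridgeless graph with an inner vertex has a vertex m such that the edges on
-- paths through m are a serial composition at m, in parallel with all other
-- edges. In a graph with a bridge, an edge can be deleted if its source has
-- another outgoing and its target another incoming edge, and contracted
-- otherwise; some such step keeps a bridge unless the graph is the Braess graph itself.

open import Defs
open import Data.Bool using (Bool; true; false; if_then_else_)
open import Data.Empty using (⊥; ⊥-elim)
open import Data.Fin using (Fin; zero; suc; punchOut)
open import Data.Fin.Induction using (spo-wellFounded; spo-noetherian)
open import Data.Fin.Properties using (_≟_; any?; all?; suc-injective; injective⇒≤; punchOut-injective)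
open import Data.Fin.Subset as Subset using (Subset; _∈_; _∉_; _⊆_; ∣_∣; ⁅_⁆; _∪_; _-_; inside; outside)
import Data.Fin.Subset.Properties as Subset
open import Data.List.Membership.Propositional as List using ()
open import Data.List.Relation.Unary.All as All using (All; []; _∷_)
open import Data.List.Relation.Unary.AllPairs using ([]; _∷_)
open import Data.List.Relation.Unary.Any as Any using (here; there)
open import Data.Nat using (ℕ; zero; suc; _≤_; _<_; z≤n; s≤s)
open import Data.Nat.Induction using (<-wellFounded)
import Data.Nat.Properties as ℕ
open import Data.Product using (Σ; Σ-syntax; ∃; ∃-syntax; _×_; _,_; proj₁; proj₂)
open import Data.Sum using (_⊎_; inj₁; inj₂; [_,_]′; swap)
open import Data.Unit using (⊤; tt)
open import Data.Vec using ([]; _∷_; tabulate; here; there)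
open import Data.Vec.Properties using (lookup∘tabulate; []=⇒lookup; lookup⇒[]=)
open import Function using (_∘_; id; flip)
open import Function.Bundles using (_⇔_; mk⇔)
open import Function.Definitions using (Injective)
open import Induction.WellFounded using (Acc; acc)
open import Relation.Binary.Construct.Closure.ReflexiveTransitive using (Star; ε; _◅_; _◅◅_)
open import Relation.Binary.PropositionalEquality
open import Relation.Binary.Structures using (IsStrictPartialOrder)
open import Relation.Nullary using (¬_; Dec; yes; no; does; contradiction; ¬?; _×-dec_; _⊎-dec_)
open import Relation.Nullary.Decidable using (decidable-stable; map′; toWitness; _→-dec_; dec-true)
open import Relation.Unary using (Decidable)

-- Paths

-- A d-embedding is a sequence of operations up to isomorphism and awkward to take apart. A bridge
-- is three paths with a single disjointness condition; since `M` may meet `A` and `B` anywhere,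
-- bridges pass easily through splits, gluings, deletions and contractions. The way back from
-- bridges to d-embeddings is a descent on the number of edges. The reductions are chosen to be
-- inverses of the three operations: deletion undoes an Addition, and the two companion edges keep
-- every vertex on an s-t path; where a companion is missing, contraction undoes a split. If the
-- Braess graph is not d-embedded in `G`, then no reduction of `G` may keep a bridge, and this
-- rigidity, applied to every bridge of `G`, forces exactly five edges. The descent is by
-- contradiction and yields only `¬ ¬ DEmbedded`. This is enough, because condition (2) is itself a
-- negation.

V E : Graph → Set
V G = Fin (nV G)
E G = Fin (nE G)

infix 4 _∈ᵥ_ _∈ₑ_
infixr 5 _⧺_

_∈ᵥ_ : ∀ {G u v} → V G → Path G u v → Set
x ∈ᵥ p = x List.∈ verticesOf p

_∈ₑ_ : ∀ {G u v} → E G → Path G u v → Set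
e ∈ₑ p = e List.∈ edgesOf p

_⧺_ : ∀ {G u v w} → Path G u v → Path G v w → Path G u w
[] ⧺ q = q
(e ∷ (eq , p)) ⧺ q = e ∷ (eq , p ⧺ q)

edge : ∀ {G} e → Path G (src G e) (tgt G e)
edge e = e ∷ (refl , [])

start∈ : ∀ {G u v} (p : Path G u v) → u ∈ᵥ p
start∈ [] = here refl
start∈ (e ∷ _) = here refl

end∈ : ∀ {G u v} (p : Path G u v) → v ∈ᵥ p
end∈ [] = here refl
end∈ (e ∷ (_ , p)) = there (end∈ p)

∈ᵥ-⧺⁻ : ∀ {G u v w x} (p : Path G u v) (q : Path G v w) → x ∈ᵥ (p ⧺ q) → x ∈ᵥ p ⊎ x ∈ᵥ q
∈ᵥ-⧺⁻ [] q i = inj₂ i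
∈ᵥ-⧺⁻ (e ∷ (_ , p)) q (here eq) = inj₁ (here eq)
∈ᵥ-⧺⁻ (e ∷ (_ , p)) q (there i) with ∈ᵥ-⧺⁻ p q i
... | inj₁ j = inj₁ (there j)
... | inj₂ j = inj₂ j

∈ₑ-⧺⁺ˡ : ∀ {G u v w e} (p : Path G u v) (q : Path G v w) → e ∈ₑ p → e ∈ₑ (p ⧺ q)
∈ₑ-⧺⁺ˡ (_ ∷ _) q (here eq) = here eq
∈ₑ-⧺⁺ˡ (_ ∷ (_ , p)) q (there i) = there (∈ₑ-⧺⁺ˡ p q i)

∈ₑ-⧺⁺ʳ : ∀ {G u v w e} (p : Path G u v) {q : Path G v w} → e ∈ₑ q → e ∈ₑ (p ⧺ q)
∈ₑ-⧺⁺ʳ [] i = i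
∈ₑ-⧺⁺ʳ (_ ∷ (_ , p)) i = there (∈ₑ-⧺⁺ʳ p i)

∈ₑ-⧺⁻ : ∀ {G u v w e} (p : Path G u v) (q : Path G v w) → e ∈ₑ (p ⧺ q) → e ∈ₑ p ⊎ e ∈ₑ q
∈ₑ-⧺⁻ [] q i = inj₂ i
∈ₑ-⧺⁻ (_ ∷ (_ , p)) q (here eq) = inj₁ (here eq)
∈ₑ-⧺⁻ (_ ∷ (_ , p)) q (there i) with ∈ₑ-⧺⁻ p q i
... | inj₁ j = inj₁ (there j)
... | inj₂ j = inj₂ j

prefix : ∀ {G u v x} (p : Path G u v) → x ∈ᵥ p →
         Σ[ q ∈ Path G u x ] (∀ {y} → y ∈ᵥ q → y ∈ᵥ p) × (∀ {e} → e ∈ₑ q → e ∈ₑ p)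
prefix [] (here refl) = [] , id , id
prefix (e ∷ (eq , p)) (here refl) = [] , (λ { (here r) → here r }) , λ ()
prefix (e ∷ (eq , p)) (there i) with prefix p i
... | q , vs , es = e ∷ (eq , q) ,
      (λ { (here r) → here r ; (there j) → there (vs j) }) ,
      (λ { (here r) → here r ; (there j) → there (es j) })

suffix : ∀ {G u v x} (p : Path G u v) → x ∈ᵥ p →
         Σ[ q ∈ Path G x v ] (∀ {y} → y ∈ᵥ q → y ∈ᵥ p) × (∀ {e} → e ∈ₑ q → e ∈ₑ p)
suffix [] (here refl) = [] , id , id
suffix p@(_ ∷ _) (here refl) = p , id , id
suffix (e ∷ (eq , p)) (there i) with suffix p i
... | q , vs , es = q , (λ j → there (vs j)) , λ j → there (es j)

before : ∀ {G u v e} (p : Path G u v) → e ∈ₑ p → Path G u (src G e)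
before (e ∷ (refl , p)) (here refl) = []
before (e ∷ (eq , p)) (there i) = e ∷ (eq , before p i)

after : ∀ {G u v e} (p : Path G u v) → e ∈ₑ p → Path G (tgt G e) v
after (e ∷ (eq , p)) (here refl) = p
after (e ∷ (eq , p)) (there i) = after p i

src∈ : ∀ {G u v e} (p : Path G u v) → e ∈ₑ p → src G e ∈ᵥ p
src∈ (e ∷ (refl , p)) (here refl) = here refl
src∈ (e ∷ (eq , p)) (there i) = there (src∈ p i)

tgt∈ : ∀ {G u v e} (p : Path G u v) → e ∈ₑ p → tgt G e ∈ᵥ p
tgt∈ (e ∷ (refl , p)) (here refl) = there (start∈ p)
tgt∈ (e ∷ (eq , p)) (there i) = there (tgt∈ p i)

lastEdge : ∀ {G u v} (p : Path G u v) → u ≢ v → Σ[ e ∈ E G ] e ∈ₑ p × tgt G e ≡ v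
lastEdge [] u≢v = contradiction refl u≢v
lastEdge {G} {v = v} (e ∷ (_ , p)) _ with tgt G e ≟ v
... | yes eq = e , here refl , eq
... | no neq with lastEdge p neq
...   | f , i , eq = f , there i , eq

firstEdge : ∀ {G u v} (p : Path G u v) → u ≢ v → Σ[ e ∈ E G ] e ∈ₑ p × src G e ≡ u
firstEdge [] u≢v = contradiction refl u≢v
firstEdge (e ∷ (eq , _)) _ = e , here refl , eq

crossing : ∀ {G u v} {X : V G → Set} → (∀ x → Dec (X x)) → (p : Path G u v) → X u → ¬ X v →
           Σ[ e ∈ E G ] e ∈ₑ p × X (src G e) × ¬ X (tgt G e)
crossing X? [] Xu ¬Xv = contradiction Xu ¬Xv
crossing {G} X? (e ∷ (refl , p)) Xu ¬Xv with X? (tgt G e)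
... | no ¬Xt = e , here refl , Xu , ¬Xt
... | yes Xt with crossing X? p Xt ¬Xv
... | f , i , h = f , there i , h

-- Edges go to paths rather than edges: a split can replace an edge by two, and a contraction
-- replaces one by none.
mapPath : ∀ {G H u v} (π : V G → V H) (p : Path G u v) →
          (∀ {e} → e ∈ₑ p → Path H (π (src G e)) (π (tgt G e))) → Path H (π u) (π v)
mapPath π [] φ = []
mapPath π (e ∷ (refl , p)) φ = φ (here refl) ⧺ mapPath π p (φ ∘ there)

-- `R` says which vertices of `G` a vertex of `H` stands for. It is a relation because embeddings
-- give a map from `G` to `H`, splits a map back, and contractions let one vertex stand for two.
mapPath-∈ᵥ : ∀ {G H u v} (R : V G → V H → Set) {π : V G → V H} → (∀ x → R x (π x)) →
             (p : Path G u v) (φ : ∀ {e} → e ∈ₑ p → Path H (π (src G e)) (π (tgt G e))) →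
             (∀ {e} (i : e ∈ₑ p) {y} → y ∈ᵥ φ i → R (src G e) y ⊎ R (tgt G e) y) →
             ∀ {y} → y ∈ᵥ mapPath π p φ → ∃[ x ] x ∈ᵥ p × R x y
mapPath-∈ᵥ R Rπ [] φ φ-R (here refl) = _ , here refl , Rπ _
mapPath-∈ᵥ R Rπ (e ∷ (refl , p)) φ φ-R i with ∈ᵥ-⧺⁻ (φ (here refl)) _ i
... | inj₂ j with mapPath-∈ᵥ R Rπ p (φ ∘ there) (λ k → φ-R (there k)) j
...   | x , x∈ , r = x , there x∈ , r
mapPath-∈ᵥ R Rπ (e ∷ (refl , p)) φ φ-R i | inj₁ j with φ-R (here refl) j
... | inj₁ r = _ , here refl , r
... | inj₂ r = _ , there (start∈ p) , r

-- The path form of an embedded Braess graph: an a–b path bridging disjoint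
-- paths x → b and a → y.
record Bridge (G : Graph) (x y : V G) : Set where
  constructor bridge
  field
    {a b} : V G
    A : Path G x b
    B : Path G a y
    M : Path G a b
    disjoint : ∀ {v} → v ∈ᵥ A → v ∈ᵥ B → ⊥

Bad : Graph → Set
Bad G = Bridge G (s G) (t G)

-- Transport of bridges along graph maps and d-embedding steps

bridge-map : ∀ {G H x y} (R : V G → V H → Set) (π : V G → V H) → (∀ v → R v (π v)) →
             (φ : ∀ e → Path H (π (src G e)) (π (tgt G e))) →
             (∀ e {y} → y ∈ᵥ φ e → R (src G e) y ⊎ R (tgt G e) y) →
             (br : Bridge G x y) →
             (∀ {v w z} → v ∈ᵥ Bridge.A br → w ∈ᵥ Bridge.B br → R v z → R w z → ⊥) →
             Bridge H (π x) (π y)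
bridge-map R π Rπ φ φ-R (bridge A B M _) dis =
  bridge (mapPath π A (λ {e} _ → φ e)) (mapPath π B (λ {e} _ → φ e)) (mapPath π M (λ {e} _ → φ e))
    λ i j → let v , v∈ , r = mapPath-∈ᵥ R Rπ A _ (λ {e} _ → φ-R e) i
                w , w∈ , r′ = mapPath-∈ᵥ R Rπ B _ (λ {e} _ → φ-R e) j
            in dis v∈ w∈ r r′

-- `ρ` projects the image of each edge onto the ends of that edge, so a vertex common to both image
-- paths would project to a vertex common to `A` and `B`.
bad-pull : ∀ {G H} (π : V G → V H) (ρ : V H → V G) → (∀ v → ρ (π v) ≡ v) →
           (φ : ∀ e → Path H (π (src G e)) (π (tgt G e))) →
           (∀ e {y} → y ∈ᵥ φ e → ρ y ≡ src G e ⊎ ρ y ≡ tgt G e) →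
           π (s G) ≡ s H → π (t G) ≡ t H → Bad G → Bad H
bad-pull {G} {H} π ρ ρπ φ φ-ρ s-eq t-eq br =
  subst₂ (Bridge H) s-eq t-eq
    (bridge-map (λ v y → ρ y ≡ v) π ρπ φ φ-ρ br
      (λ i j eq eq′ → Bridge.disjoint br i (subst (_∈ᵥ _) (trans (sym eq′) eq) j)))

edge-on : ∀ {G u v} e → src G e ≡ u → tgt G e ≡ v → Path G u v
edge-on e refl refl = edge e

edge-on-∈ᵥ : ∀ {G u v x} e (p : src G e ≡ u) (q : tgt G e ≡ v) → x ∈ᵥ edge-on {G} e p q → x ≡ u ⊎ x ≡ v
edge-on-∈ᵥ e refl refl (here eq) = inj₁ eq
edge-on-∈ᵥ e refl refl (there (here eq)) = inj₂ eq

edge-on-∈ₑ : ∀ {G u v f} e (p : src G e ≡ u) (q : tgt G e ≡ v) → f ∈ₑ edge-on {G} e p q → f ≡ e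
edge-on-∈ₑ e refl refl (here eq) = eq

stay : ∀ {G u v} → u ≡ v → Path G u v
stay refl = []

stay-∈ᵥ : ∀ {G u v x} (eq : u ≡ v) → x ∈ᵥ stay {G} eq → x ≡ u
stay-∈ᵥ refl (here eq) = eq

-- After a split, an edge that was moved to the new vertex is replaced by its composite with the new
-- edge. The new vertex projects to the vertex that was split, which is already an end of the moved
-- edge.
step-bad : ∀ {G H} → Step G H → Bad G → Bad H
step-bad (addition G a b _) =
  bad-pull id id (λ _ → refl) (λ e → edge (suc e))
    (λ { e (here eq) → inj₁ eq ; e (there (here eq)) → inj₂ eq }) refl refl
step-bad (fsplit G a mv _ mv-src _) = bad-pull suc ρ (λ _ → refl) (λ e → φ e (mv e) refl) (λ e → φ-ρ e (mv e) refl) refl refl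
  where
  ρ : Fin (suc (nV G)) → V G
  ρ zero = a
  ρ (suc v) = v
  φ : ∀ e c → mv e ≡ c → Path (fwdSplit G a mv) (suc (src G e)) (suc (tgt G e))
  φ e true eq = zero ∷ (cong suc (sym (mv-src e eq)) , (edge-on (suc e) (cong (λ c → if c then zero else suc (src G e)) eq) refl))
  φ e false eq = edge-on (suc e) (cong (λ c → if c then zero else suc (src G e)) eq) refl
  φ-ρ : ∀ e c eq {y} → y ∈ᵥ φ e c eq → ρ y ≡ src G e ⊎ ρ y ≡ tgt G e
  φ-ρ e true eq (here refl) = inj₁ refl
  φ-ρ e true eq (there i) with edge-on-∈ᵥ {fwdSplit G a mv} (suc e) (cong (λ c → if c then zero else suc (src G e)) eq) refl i
  ... | inj₁ refl = inj₁ (sym (mv-src e eq))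
  ... | inj₂ refl = inj₂ refl
  φ-ρ e false eq i with edge-on-∈ᵥ {fwdSplit G a mv} (suc e) (cong (λ c → if c then zero else suc (src G e)) eq) refl i
  ... | inj₁ refl = inj₁ refl
  ... | inj₂ refl = inj₂ refl
step-bad (bsplit G b mv _ mv-tgt _) = bad-pull suc ρ (λ _ → refl) (λ e → φ e (mv e) refl) (λ e → φ-ρ e (mv e) refl) refl refl
  where
  ρ : Fin (suc (nV G)) → V G
  ρ zero = b
  ρ (suc v) = v
  toZero : ∀ e → mv e ≡ true → Path (bwdSplit G b mv) (suc (src G e)) zero
  toZero e eq = edge-on (suc e) refl (cong (λ c → if c then zero else suc (tgt G e)) eq)
  φ : ∀ e c → mv e ≡ c → Path (bwdSplit G b mv) (suc (src G e)) (suc (tgt G e))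
  φ e true eq = toZero e eq ⧺ edge-on zero refl (cong suc (sym (mv-tgt e eq)))
  φ e false eq = edge-on (suc e) refl (cong (λ c → if c then zero else suc (tgt G e)) eq)
  φ-ρ : ∀ e c eq {y} → y ∈ᵥ φ e c eq → ρ y ≡ src G e ⊎ ρ y ≡ tgt G e
  φ-ρ e true eq i with ∈ᵥ-⧺⁻ (toZero e eq) _ i
  ... | inj₁ j with edge-on-∈ᵥ {bwdSplit G b mv} (suc e) refl (cong (λ c → if c then zero else suc (tgt G e)) eq) j
  ...   | inj₁ refl = inj₁ refl
  ...   | inj₂ refl = inj₂ (sym (mv-tgt e eq))
  φ-ρ e true eq i | inj₂ j with edge-on-∈ᵥ {bwdSplit G b mv} zero refl (cong suc (sym (mv-tgt e eq))) j
  ...   | inj₁ refl = inj₂ (sym (mv-tgt e eq))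
  ...   | inj₂ refl = inj₂ refl
  φ-ρ e false eq i with edge-on-∈ᵥ {bwdSplit G b mv} (suc e) refl (cong (λ c → if c then zero else suc (tgt G e)) eq) i
  ... | inj₁ refl = inj₁ refl
  ... | inj₂ refl = inj₂ refl

bad-embed : ∀ {G H} (fV : V G → V H) (fE : E G → E H) → Injective _≡_ _≡_ fV →
            (∀ e → src H (fE e) ≡ fV (src G e)) → (∀ e → tgt H (fE e) ≡ fV (tgt G e)) →
            ∀ {x y} → Bridge G x y → Bridge H (fV x) (fV y)
bad-embed fV fE inj src-hom tgt-hom br =
  bridge-map (λ v w → w ≡ fV v) fV (λ _ → refl) (λ e → edge-on (fE e) (src-hom e) (tgt-hom e))
    (λ e → edge-on-∈ᵥ (fE e) (src-hom e) (tgt-hom e)) br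
    (λ i j eq eq′ → Bridge.disjoint br i (subst (_∈ᵥ _) (inj (trans (sym eq′) eq)) j))

iso-bad : ∀ {G H} → Iso G H → Bad G → Bad H
iso-bad {G} {H} i br = subst₂ (Bridge H) s-hom t-hom (bad-embed fV fE (proj₁ fV-bij) src-hom tgt-hom br)
  where open Iso i

braess-bad : Bad Braess
braess-bad = bridge {a = suc zero} {b = suc (suc zero)} (edge (suc zero)) (edge (suc (suc (suc zero)))) (edge (suc (suc zero)))
  λ { (here refl) (here ()) ; (here refl) (there (here ())) ; (here refl) (there (there ()))
    ; (there (here refl)) (here ()) ; (there (here refl)) (there (here ())) ; (there (here refl)) (there (there ())) }

dEmbedded-bad : ∀ {G} → DEmbedded Braess G → Bad G
dEmbedded-bad (H , steps , iso) = iso-bad iso (go steps braess-bad)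
  where
  go : ∀ {G H} → Star Step G H → Bad G → Bad H
  go ε br = br
  go (st ◅ sts) br = go sts (step-bad st br)

-- Series-parallel graphs have no bridge

Source Sink : (G : Graph) → V G → Set
Source G v = ∀ e → tgt G e ≢ v
Sink G v = ∀ e → src G e ≢ v

source-path : ∀ {G u v} → Source G v → Path G u v → u ≡ v
source-path so [] = refl
source-path so (e ∷ (_ , p)) = contradiction (source-path so p) (so e)

sink-path : ∀ {G u v} → Sink G u → Path G u v → u ≡ v
sink-path si [] = refl
sink-path si (e ∷ (eq , _)) = contradiction eq (si e)

sp-source : ∀ {G} → IsSP G → Source G (s G)
sp-source {G} (single i) e eq with proj₂ (Iso.fE-bij i) e
... | zero , h with proj₁ (Iso.fV-bij i) (trans (sym (Iso.tgt-hom i zero)) (trans (cong (tgt G) (h refl)) (trans eq (sym (Iso.s-hom i)))))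
...   | ()
sp-source (serial sp₁ sp₂ c) e eq with E-cover (SerialComp.emb c) e
... | inj₁ (e₁ , refl) = sp-source sp₁ e₁ (fV₁-inj emb (trans (sym (tgt₁ emb e₁)) (trans eq s-is)))
  where open SerialComp c
... | inj₂ (e₂ , refl) = sp-source sp₂ e₂ (proj₂ (glue _ _ (trans (sym s-is) (trans (sym eq) (tgt₂ emb e₂)))))
  where open SerialComp c
sp-source (parallel sp₁ sp₂ c) e eq with E-cover (ParallelComp.emb c) e
... | inj₁ (e₁ , refl) = sp-source sp₁ e₁ (fV₁-inj emb (trans (sym (tgt₁ emb e₁)) (trans eq s-is)))
  where open ParallelComp c
... | inj₂ (e₂ , refl) = sp-source sp₂ e₂ (fV₂-inj emb (trans (sym (tgt₂ emb e₂)) (trans eq (trans s-is glued-s))))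
  where open ParallelComp c

sp-sink : ∀ {G} → IsSP G → Sink G (t G)
sp-sink {G} (single i) e eq with proj₂ (Iso.fE-bij i) e
... | zero , h with proj₁ (Iso.fV-bij i) (trans (sym (Iso.src-hom i zero)) (trans (cong (src G) (h refl)) (trans eq (sym (Iso.t-hom i)))))
...   | ()
sp-sink (serial sp₁ sp₂ c) e eq with E-cover (SerialComp.emb c) e
... | inj₁ (e₁ , refl) = sp-sink sp₁ e₁ (proj₁ (glue _ _ (trans (sym (src₁ emb e₁)) (trans eq t-is))))
  where open SerialComp c
... | inj₂ (e₂ , refl) = sp-sink sp₂ e₂ (fV₂-inj emb (trans (sym (src₂ emb e₂)) (trans eq t-is)))
  where open SerialComp c
sp-sink (parallel sp₁ sp₂ c) e eq with E-cover (ParallelComp.emb c) e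
... | inj₁ (e₁ , refl) = sp-sink sp₁ e₁ (fV₁-inj emb (trans (sym (src₁ emb e₁)) (trans eq t-is)))
  where open ParallelComp c
... | inj₂ (e₂ , refl) = sp-sink sp₂ e₂ (fV₂-inj emb (trans (sym (src₂ emb e₂)) (trans eq (trans t-is glued-t))))
  where open ParallelComp c

-- Only vertices are tracked, since disjointness is all that gets transported.
record Lift (H : Graph) {G : Graph} (f : V H → V G) {u w} (p : Path G u w) (x y : V H) : Set where
  constructor lift
  field
    path : Path H x y
    along : ∀ {v} → v ∈ᵥ path → f v ∈ᵥ p

lift-∷ : ∀ {H G} {f : V H → V G} {u w e} {eq : src G e ≡ u} {p : Path G (tgt G e) w} {y} e′ →
         f (src H e′) ≡ u → Lift H f p (tgt H e′) y → Lift H f (e ∷ (eq , p)) (src H e′) y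
lift-∷ e′ eq (lift q al) = lift (e′ ∷ (refl , q)) λ { (here refl) → here eq ; (there i) → there (al i) }

lift-[] : ∀ {H G} {f : V H → V G} {u w} (p : Path G u w) {x} → f x ∈ᵥ p → Lift H f p x x
lift-[] p i = lift [] λ { (here refl) → i }

-- A path in the second part cannot return: the only vertex shared with `G₁` is `t G₁`, and no edge
-- of `G₁` leaves it.
serial-lift₂ : ∀ {G₁ G₂ G} (c : SerialComp G₁ G₂ G) → Sink G₁ (t G₁) →
               let open SerialComp c in
               ∀ {u w} (p : Path G u w) {x} → fV₂ emb x ≡ u →
               ∃[ y ] fV₂ emb y ≡ w × Lift G₂ (fV₂ emb) p x y
serial-lift₂ c si [] eq = _ , eq , lift-[] [] (here eq)
serial-lift₂ c si (e ∷ (refl , p)) eq with E-cover (SerialComp.emb c) e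
... | inj₁ (e₁ , refl) =
  contradiction (proj₁ (SerialComp.glue c _ _ (sym (trans eq (src₁ (SerialComp.emb c) e₁))))) (si e₁)
... | inj₂ (e₂ , refl) with fV₂-inj emb (trans eq (src₂ emb e₂)) | serial-lift₂ c si p (sym (tgt₂ emb e₂))
  where open SerialComp c
...   | refl | y , eq′ , l = y , eq′ , lift-∷ e₂ eq l

-- A path from `G₁` into `G₂` must pass the glued vertex, where it is cut into its two lifts.
serial-lift₁ : ∀ {G₁ G₂ G} (c : SerialComp G₁ G₂ G) → Sink G₁ (t G₁) →
               let open SerialComp c in
               ∀ {u w} (p : Path G u w) {x} → fV₁ emb x ≡ u →
               (∃[ y ] fV₁ emb y ≡ w × Lift G₁ (fV₁ emb) p x y) ⊎
               (Lift G₁ (fV₁ emb) p x (t G₁) × ∃[ y ] fV₂ emb y ≡ w × Lift G₂ (fV₂ emb) p (s G₂) y)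
serial-lift₁ c si [] eq = inj₁ (_ , eq , lift-[] [] (here eq))
serial-lift₁ c si p₀@(e ∷ (refl , p)) {x} eq with E-cover (SerialComp.emb c) e
... | inj₁ (e₁ , refl) with fV₁-inj emb (trans eq (src₁ emb e₁)) | serial-lift₁ c si p (sym (tgt₁ emb e₁))
  where open SerialComp c
...   | refl | inj₁ (y , eq′ , l) = inj₁ (y , eq′ , lift-∷ e₁ eq l)
...   | refl | inj₂ (l₁ , y , eq′ , l₂) = inj₂ (lift-∷ e₁ eq l₁ , y , eq′ , lift (Lift.path l₂) (there ∘ Lift.along l₂))
serial-lift₁ {G₂ = G₂} c si p₀@(e ∷ (refl , p)) {x} eq | inj₂ (e₂ , refl)
  with glue _ _ (trans eq (src₂ emb e₂)) | serial-lift₂ c si p (sym (tgt₂ emb e₂))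
  where open SerialComp c
... | refl , s≡ | y , eq′ , l with lift-∷ {eq = refl} e₂ (sym (src₂ (SerialComp.emb c) e₂)) l
...   | l₂ = inj₂ (lift-[] p₀ (here eq) , y , eq′ , subst (λ z → Lift G₂ _ p₀ z y) s≡ l₂)

-- Only one of the disjoint paths `A` and `B` can use the glued vertex. If `a` is in `G₁`, then `B`
-- uses it, which keeps `A` and `b` in `G₁`, and `B` cut at that vertex completes a bridge of `G₁`.
-- If `a` is in `G₂`, so are `B` and `M`, and the part of `A` inside `G₂` completes a bridge there.
serial-¬bad : ∀ {G₁ G₂ G} → Sink G₁ (t G₁) → SerialComp G₁ G₂ G → ¬ Bad G₁ → ¬ Bad G₂ → ¬ Bad G
serial-¬bad {G₁} {G₂} {G} si c ¬bad₁ ¬bad₂ (bridge {a} {b} A B M dis) = go (V-cover emb a)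
  where
  open SerialComp c
  go₂ : ∀ {a₂ b₂} → Lift G₂ (fV₂ emb) A (s G₂) b₂ → Lift G₂ (fV₂ emb) B a₂ (t G₂) → Path G₂ a₂ b₂ → ⊥
  go₂ (lift A₂ A-al) (lift B₂ B-al) M₂ = ¬bad₂ (bridge A₂ B₂ M₂ λ i j → dis (A-al i) (B-al j))
  go₁ : ∀ {a₁} → fV₁ emb a₁ ≡ a → Lift G₁ (fV₁ emb) B a₁ (t G₁) → ⊥
  go₁ eq (lift B₁ B-al) with serial-lift₁ c si M eq | serial-lift₁ c si A (sym s-is)
  ... | _ | inj₂ (l , _) = dis (Lift.along l (end∈ (Lift.path l))) (B-al (end∈ B₁))
  ... | inj₁ (b₁ , eq₁ , lift M₁ _) | inj₁ (b₁′ , eq₁′ , lift A₁ A-al) with fV₁-inj emb (trans eq₁ (sym eq₁′))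
  ...   | refl = ¬bad₁ (bridge A₁ B₁ M₁ λ i j → dis (A-al i) (B-al j))
  go₁ eq (lift B₁ B-al) | inj₂ (_ , b₂ , eq₂ , _) | inj₁ (b₁ , eq₁ , lift A₁ A-al) with glue _ _ (trans eq₁ (sym eq₂))
  ... | refl , _ = dis (A-al (end∈ A₁)) (B-al (end∈ B₁))
  go : (∃[ a₁ ] fV₁ emb a₁ ≡ a) ⊎ (∃[ a₂ ] fV₂ emb a₂ ≡ a) → ⊥
  go (inj₁ (a₁ , eq)) with serial-lift₁ c si B eq
  ... | inj₂ (l , _) = go₁ eq l
  ... | inj₁ (y , eq₁ , l) with glue _ _ (trans eq₁ t-is)
  ...   | refl , _ = go₁ eq l
  go (inj₂ (a₂ , eq)) with serial-lift₂ c si B eq | serial-lift₂ c si M eq | serial-lift₁ c si A (sym s-is)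
  ... | y , eqB , lB | b₂ , eqM , lM | inj₂ (_ , b₂′ , eqA , lA) with fV₂-inj emb (trans eqB t-is) | fV₂-inj emb (trans eqM (sym eqA))
  ...   | refl | refl = go₂ lA lB (Lift.path lM)
  go (inj₂ (a₂ , eq)) | y , eqB , lB | b₂ , eqM , lM | inj₁ (b₁ , eqA , lA) with fV₂-inj emb (trans eqB t-is) | glue _ _ (trans eqA (sym eqM))
  -- Here `b` is the glued vertex itself, and the part of `A` inside `G₂` is the empty path at
  -- `s G₂`.
  ...   | refl | refl , refl = go₂ (lift-[] A (subst (_∈ᵥ A) (sym eqM) (end∈ A))) lB (Lift.path lM)

parallel-swap : ∀ {G₁ G₂ G} → ParallelComp G₁ G₂ G → ParallelComp G₂ G₁ G
parallel-swap c = record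
  { emb = record
    { fV₁ = fV₂ emb ; fV₂ = fV₁ emb ; fE₁ = fE₂ emb ; fE₂ = fE₁ emb
    ; fV₁-inj = fV₂-inj emb ; fV₂-inj = fV₁-inj emb ; fE₁-inj = fE₂-inj emb ; fE₂-inj = fE₁-inj emb
    ; src₁ = src₂ emb ; tgt₁ = tgt₂ emb ; src₂ = src₁ emb ; tgt₂ = tgt₁ emb
    ; V-cover = swap ∘ V-cover emb ; E-cover = swap ∘ E-cover emb
    ; E-disj = λ e₁ e₂ eq → E-disj emb e₂ e₁ (sym eq) }
  ; glue = λ v₁ v₂ eq → [ (λ (p , q) → inj₁ (q , p)) , (λ (p , q) → inj₂ (q , p)) ]′ (glue v₂ v₁ (sym eq))
  ; glued-s = sym glued-s ; glued-t = sym glued-t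
  ; s-is = trans s-is glued-s ; t-is = trans t-is glued-t }
  where open ParallelComp c

-- Once away from `s`, a path could change sides only at `t`, which no edge leaves; and it never
-- returns to `s`, which no edge enters.
parallel-lift : ∀ {G₁ G₂ G} (c : ParallelComp G₁ G₂ G) → Source G₁ (s G₁) → Sink G₂ (t G₂) →
                let open ParallelComp c in
                ∀ {u w} (p : Path G u w) {x} → x ≢ s G₁ → fV₁ emb x ≡ u →
                ∃[ y ] fV₁ emb y ≡ w × Lift G₁ (fV₁ emb) p x y
parallel-lift c so si [] x≢s eq = _ , eq , lift-[] [] (here eq)
parallel-lift c so si (e ∷ (refl , p)) x≢s eq with E-cover (ParallelComp.emb c) e
... | inj₁ (e₁ , refl) with fV₁-inj emb (trans eq (src₁ emb e₁)) | parallel-lift c so si p (so e₁) (sym (tgt₁ emb e₁))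
  where open ParallelComp c
...   | refl | y , eq′ , l = y , eq′ , lift-∷ e₁ eq l
parallel-lift c so si (e ∷ (refl , p)) x≢s eq | inj₂ (e₂ , refl) with glue _ _ (trans eq (src₂ emb e₂))
  where open ParallelComp c
... | inj₁ (x≡s , _) = contradiction x≡s x≢s
... | inj₂ (_ , q) = contradiction q (si e₂)

-- The first edge fixes the side. Had it been an edge of `G₂`, the path would end in a vertex shared
-- by both sides and different from `s`, hence in `t`.
parallel-lift-from-s : ∀ {G₁ G₂ G} (c : ParallelComp G₁ G₂ G) → Source G₁ (s G₁) → Source G₂ (s G₂) →
                       Sink G₁ (t G₁) → Sink G₂ (t G₂) →
                       let open ParallelComp c in
                       ∀ {u w} (p : Path G u w) {y} → u ≡ s G → fV₁ emb y ≡ w → y ≢ t G₁ →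
                       Lift G₁ (fV₁ emb) p (s G₁) y
parallel-lift-from-s c so₁ so₂ si₁ si₂ [] u≡s eq y≢t with fV₁-inj emb (trans eq (trans u≡s s-is))
  where open ParallelComp c
... | refl = lift-[] [] (here eq)
parallel-lift-from-s {G₁} c so₁ so₂ si₁ si₂ p₀@(e ∷ (refl , p)) {y} u≡s eq y≢t with E-cover (ParallelComp.emb c) e
... | inj₁ (e₁ , refl) with parallel-lift c so₁ si₂ p (so₁ e₁) (sym (tgt₁ emb e₁))
  where open ParallelComp c
...   | y′ , eq′ , l with fV₁-inj (ParallelComp.emb c) (trans eq′ (sym eq))
                        | fV₁-inj (ParallelComp.emb c) (trans (sym (src₁ (ParallelComp.emb c) e₁)) (trans u≡s (ParallelComp.s-is c)))
...     | refl | q = subst (λ z → Lift G₁ _ p₀ z y) q (lift-∷ {eq = refl} e₁ (sym (src₁ (ParallelComp.emb c) e₁)) l)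
parallel-lift-from-s c so₁ so₂ si₁ si₂ p₀@(e ∷ (refl , p)) {y} u≡s eq y≢t | inj₂ (e₂ , refl)
  with parallel-lift (parallel-swap c) so₂ si₁ p (so₂ e₂) (sym (tgt₂ (ParallelComp.emb c) e₂))
... | y₂ , eq₂ , l with ParallelComp.glue c _ _ (trans eq (sym eq₂))
...   | inj₁ (_ , refl) = contradiction (source-path so₂ (Lift.path l)) (so₂ e₂)
...   | inj₂ (y≡t , _) = contradiction y≡t y≢t

-- The bridge stays on the side of `a`: as `s` lies on `A`, it is not `a`, so `B` and `M` stay
-- there; as `t` lies on `B`, it is not `b`, so `A` stays there too.
parallel-¬bad₁ : ∀ {G₁ G₂ G} → Source G₁ (s G₁) → Source G₂ (s G₂) → Sink G₁ (t G₁) → Sink G₂ (t G₂) →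
                 (c : ParallelComp G₁ G₂ G) → ¬ Bad G₁ →
                 (br : Bad G) → ∃[ a₁ ] fV₁ (ParallelComp.emb c) a₁ ≡ Bridge.a br → ⊥
parallel-¬bad₁ {G₁} {G₂} {G} so₁ so₂ si₁ si₂ c ¬bad₁ (bridge A B M dis) (a₁ , refl)
  with parallel-lift c so₁ si₂ B a₁≢s refl | parallel-lift c so₁ si₂ M a₁≢s refl
  where
  open ParallelComp c
  a₁≢s : a₁ ≢ s G₁
  a₁≢s refl = dis (start∈ A) (subst (_∈ᵥ B) (sym s-is) (start∈ B))
... | y , eqB , lift B₁ B-al | b₁ , refl , lift M₁ _ with fV₁-inj (ParallelComp.emb c) (trans eqB (ParallelComp.t-is c))
...   | refl with parallel-lift-from-s c so₁ so₂ si₁ si₂ A refl refl b₁≢t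
  where
  open ParallelComp c
  b₁≢t : b₁ ≢ t G₁
  b₁≢t refl = dis (end∈ A) (B-al (end∈ B₁))
...     | lift A₁ A-al = ¬bad₁ (bridge A₁ B₁ M₁ λ i j → dis (A-al i) (B-al j))

sp-¬bad : ∀ {G} → IsSP G → ¬ Bad G
sp-¬bad sp@(single i) (bridge {a} A B M dis) with proj₂ (Iso.fV-bij i) a
... | zero , h = dis (start∈ A) (subst (_∈ᵥ B) (trans (sym (h refl)) (Iso.s-hom i)) (start∈ B))
... | suc zero , h with trans (sym (h refl)) (Iso.t-hom i)
...   | refl with sink-path (sp-sink sp) M
...     | refl = dis (end∈ A) (start∈ B)
sp-¬bad (serial sp₁ sp₂ c) = serial-¬bad (sp-sink sp₁) c (sp-¬bad sp₁) (sp-¬bad sp₂)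
sp-¬bad (parallel sp₁ sp₂ c) br with V-cover (ParallelComp.emb c) (Bridge.a br)
... | inj₁ h = parallel-¬bad₁ (sp-source sp₁) (sp-source sp₂) (sp-sink sp₁) (sp-sink sp₂) c (sp-¬bad sp₁) br h
... | inj₂ h = parallel-¬bad₁ (sp-source sp₂) (sp-source sp₁) (sp-sink sp₂) (sp-sink sp₁) (parallel-swap c) (sp-¬bad sp₂) br h

-- Minimal cuts

-- The form of the hypothesis that the inductions carry to subgraphs and contractions. Acyclicity
-- makes every path simple, so simplicity is recovered at the end by `simple`.
record Flow (G : Graph) : Set where
  field
    acyclic : ∀ e → ¬ Path G (tgt G e) (src G e)
    s≢t : s G ≢ t G
    from : ∀ v → Path G (s G) v
    to : ∀ v → Path G v (t G)

  s-source : Source G (s G)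
  s-source e eq = acyclic e (subst (λ v → Path G v (src G e)) (sym eq) (from (src G e)))

  t-sink : Sink G (t G)
  t-sink e eq = acyclic e (subst (Path G (tgt G e)) (sym eq) (to (tgt G e)))

  antisym : ∀ {u v} → Path G u v → Path G v u → u ≡ v
  antisym [] q = refl
  antisym (e ∷ (refl , p)) q = contradiction (p ⧺ q) (acyclic e)

  simple : ∀ {u v} (p : Path G u v) → Simple p
  simple [] = [] ∷ []
  simple (e ∷ (refl , p)) =
    All.tabulate (λ { i refl → acyclic e (proj₁ (prefix p i)) }) ∷ simple p

flow : ∀ {G} → TDAG G → Flow G
flow ((s≢t , _ , onV , _) , acyc) = record
  { acyclic = λ e p → contradiction (acyc _ (e ∷ (refl , p))) λ ()
  ; s≢t = s≢t
  ; from = λ v → let p , _ , i = onV v in proj₁ (prefix p i)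
  ; to = λ v → let p , _ , i = onV v in proj₁ (suffix p i) }

subset : ∀ {n} {P : Fin n → Set} → Decidable P → Subset n
subset P? = tabulate (does ∘ P?)

∈-subset⁺ : ∀ {n} {P : Fin n → Set} (P? : Decidable P) {x} → P x → x ∈ subset P?
∈-subset⁺ P? {x} Px = lookup⇒[]= x _ (trans (lookup∘tabulate _ x) (dec-true (P? x) Px))

∈-subset⁻ : ∀ {n} {P : Fin n → Set} (P? : Decidable P) {x} → x ∈ subset P? → P x
∈-subset⁻ P? {x} i with P? x | trans (sym (lookup∘tabulate (does ∘ P?) x)) ([]=⇒lookup i)
... | yes Px | _ = Px
... | no _ | ()

-- The path `p`, then `e`, then `q` leaves `X` only along `e`, so a cut contained in the boundary
-- must contain `e`.
boundary-minimal : ∀ {G} {X : V G → Set} (X? : Decidable X) → X (s G) → ¬ X (t G) →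
  (∀ e → X (src G e) → ¬ X (tgt G e) →
     (Σ[ p ∈ Path G (s G) (src G e) ] (∀ {v} → v ∈ᵥ p → X v)) ×
     (Σ[ q ∈ Path G (tgt G e) (t G) ] (∀ {v} → v ∈ᵥ q → ¬ X v))) →
  IsMinimalCut G (subset (λ e → X? (src G e) ×-dec ¬? (X? (tgt G e))))
boundary-minimal {G} {X} X? Xs ¬Xt reach = cut , minimal
  where
  C? : Decidable (λ e → X (src G e) × ¬ X (tgt G e))
  C? e = X? (src G e) ×-dec ¬? (X? (tgt G e))
  cut : IsCut G (subset C?)
  cut p avoid with crossing X? p Xs ¬Xt
  ... | e , i , h = All.lookup avoid i (∈-subset⁺ C? h)
  minimal : ∀ C' → C' ⊆ subset C? → IsCut G C' → subset C? ⊆ C'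
  minimal C' sub cut' {e} i with e Subset.∈? C'
  ... | yes i′ = i′
  ... | no ∉C' with ∈-subset⁻ C? i
  ...   | Xsrc , ¬Xtgt with reach e Xsrc ¬Xtgt
  ...     | (p , inX) , (q , outX) = contradiction (All.tabulate avoid) (cut' (p ⧺ (edge e ⧺ q)))
    where
    avoid : ∀ {f} → f ∈ₑ (p ⧺ (edge e ⧺ q)) → f ∉ C'
    avoid j f∈ with ∈-subset⁻ C? (sub f∈) | ∈ₑ-⧺⁻ p _ j
    ... | _ , ¬Xf | inj₁ k = ¬Xf (inX (tgt∈ p k))
    ... | _ | inj₂ (here refl) = ∉C' f∈
    ... | Xf , _ | inj₂ (there k) = outX (src∈ q k) Xf

-- While a contradiction is being derived, any predicate on a finite set may be taken as decidable.
-- This spares a search for the paths that avoid `B`.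
¬¬-decidable : ∀ {n} (P : Fin n → Set) → ¬ ¬ (∀ x → Dec (P x))
¬¬-decidable {zero} P k = k λ ()
¬¬-decidable {suc n} P k = ¬¬-decidable (P ∘ suc) λ d →
  (λ ¬d → ¬d (no λ p → ¬d (yes p))) λ d₀ → k λ { zero → d₀ ; (suc x) → d x }

∈⇒1≤∣∣ : ∀ {n} {S : Subset n} {x} → x ∈ S → 1 ≤ ∣ S ∣
∈⇒1≤∣∣ here = s≤s z≤n
∈⇒1≤∣∣ {S = inside ∷ _} (there i) = s≤s z≤n
∈⇒1≤∣∣ {S = outside ∷ _} (there i) = ∈⇒1≤∣∣ i

≢∈⇒2≤∣∣ : ∀ {n} {S : Subset n} {x y} → x ∈ S → y ∈ S → x ≢ y → 2 ≤ ∣ S ∣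
≢∈⇒2≤∣∣ here here x≢y = contradiction refl x≢y
≢∈⇒2≤∣∣ here (there j) _ = s≤s (∈⇒1≤∣∣ j)
≢∈⇒2≤∣∣ (there i) here _ = s≤s (∈⇒1≤∣∣ i)
≢∈⇒2≤∣∣ {S = inside ∷ _} (there i) (there j) x≢y = s≤s (∈⇒1≤∣∣ i)
≢∈⇒2≤∣∣ {S = outside ∷ _} (there i) (there j) x≢y = ≢∈⇒2≤∣∣ i j (x≢y ∘ cong suc)

1≤∣∣⇒∈ : ∀ {n} (S : Subset n) → 1 ≤ ∣ S ∣ → ∃[ x ] x ∈ S
1≤∣∣⇒∈ (inside ∷ S) _ = zero , here
1≤∣∣⇒∈ (outside ∷ S) le with 1≤∣∣⇒∈ S le
... | x , i = suc x , there i

2≤∣∣⇒≢∈ : ∀ {n} (S : Subset n) → 2 ≤ ∣ S ∣ → ∃[ x ] ∃[ y ] x ∈ S × y ∈ S × x ≢ y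
2≤∣∣⇒≢∈ (inside ∷ S) (s≤s le) with 1≤∣∣⇒∈ S le
... | x , i = zero , suc x , here , there i , λ ()
2≤∣∣⇒≢∈ (outside ∷ S) le with 2≤∣∣⇒≢∈ S le
... | x , y , i , j , x≢y = suc x , suc y , there i , there j , λ { refl → x≢y refl }

-- The cut is the boundary of the set of vertices reachable from s off B;
-- an s–a–b–t path crosses it both before a and after b.
bad⇒SPW≢1 : ∀ {G} → Flow G → Bad G → ¬ SPW≡ G 1
bad⇒SPW≢1 {G} fl (bridge {a} {b} A B M dis) (_ , max) =
  ¬¬-decidable X λ X? → contradict X?
  where
  open Flow fl
  X : V G → Set
  X v = Σ[ p ∈ Path G (s G) v ] (∀ {w} → w ∈ᵥ p → ¬ w ∈ᵥ B)
  Xs : X (s G)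
  Xs = [] , λ { (here refl) → dis (start∈ A) }
  X-prefix : ∀ {v} ((p , _) : X v) → ∀ {w} → w ∈ᵥ p → X w
  X-prefix (p , off) i = let q , vs , _ = prefix p i in q , off ∘ vs
  ∈B⇒¬X : ∀ {v} → v ∈ᵥ B → ¬ X v
  ∈B⇒¬X i (p , off) = off (end∈ p) i
  X-next : ∀ e → X (src G e) → ¬ X (tgt G e) → tgt G e ∈ᵥ B
  X-next e (p , off) ¬X = decidable-stable (Any.any? (tgt G e ≟_) (verticesOf B)) λ ∉B →
    ¬X (p ⧺ edge e , λ i → [ off , (λ { (here refl) → off (end∈ p) ; (there (here refl)) → ∉B }) ]′ (∈ᵥ-⧺⁻ p _ i))
  contradict : Decidable X → ⊥
  -- `a` and `t` lie on `B`, hence outside `X`, while `A` itself witnesses that `b` is in `X`.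
  contradict X? with crossing X? (from a) Xs (∈B⇒¬X (start∈ B))
                  | crossing X? (to b) (A , dis) (∈B⇒¬X (end∈ B))
  ... | e , i , Xe | f , j , Xf = contradiction (max S serial-S parallel-S) (ℕ.<⇒≱ (≢∈⇒2≤∣∣ e∈S f∈S e≢f))
    where
    p : Path G (s G) (t G)
    p = from a ⧺ (M ⧺ to b)
    e≢f : e ≢ f
    -- If the two crossings used the same edge, its end would lead to `a`, along `M` to `b`, and on
    -- to its start.
    e≢f refl = acyclic e (after (from a) i ⧺ (M ⧺ before (to b) j))
    S : Subset (nE G)
    S = ⁅ e ⁆ ∪ ⁅ f ⁆
    e∈S : e ∈ S
    e∈S = Subset.x∈p∪q⁺ (inj₁ (Subset.x∈⁅x⁆ e))
    f∈S : f ∈ S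
    f∈S = Subset.x∈p∪q⁺ (inj₂ (Subset.x∈⁅x⁆ f))
    S⁻ : ∀ {P : E G → Set} → P e → P f → ∀ {g} → g ∈ S → P g
    S⁻ {P} Pe Pf g∈ with Subset.x∈p∪q⁻ ⁅ e ⁆ ⁅ f ⁆ g∈
    ... | inj₁ g∈e = subst P (sym (Subset.x∈⁅y⁆⇒x≡y e g∈e)) Pe
    ... | inj₂ g∈f = subst P (sym (Subset.x∈⁅y⁆⇒x≡y f g∈f)) Pf
    serial-S : IsSerial G S
    serial-S = p , simple p , λ g → S⁻ {_∈ₑ p} (∈ₑ-⧺⁺ˡ (from a) _ i) (∈ₑ-⧺⁺ʳ (from a) (∈ₑ-⧺⁺ʳ M j))
    parallel-S : IsParallel G S
    parallel-S = _ , boundary-minimal X? Xs (∈B⇒¬X (end∈ B))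
                       (λ g Xg ¬Xg → (proj₁ Xg , X-prefix Xg) ,
                         let q , vs , _ = suffix B (X-next g Xg ¬Xg) in q , ∈B⇒¬X ∘ vs) ,
                 S⁻ {_∈ subset C?} (∈-subset⁺ C? Xe) (∈-subset⁺ C? Xf)
      where
      C? : Decidable (λ g → X (src G g) × ¬ X (tgt G g))
      C? g = X? (src G g) ×-dec ¬? (X? (tgt G g))

-- Two edges of a minimal cut on one path

avoids : ∀ {G u v} → Subset (nE G) → Path G u v → Set
avoids C p = All (_∉ C) (edgesOf p)

avoids-⧺ : ∀ {G u v w C} (p : Path G u v) (q : Path G v w) → avoids C p → avoids C q → avoids C (p ⧺ q)
avoids-⧺ [] q _ aq = aq
avoids-⧺ (e ∷ (_ , p)) q (a ∷ ap) aq = a ∷ avoids-⧺ p q ap aq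

∉-delete⇒∉ : ∀ {n} {C : Subset n} {x y} → y ∉ C - x → x ≢ y → y ∉ C
∉-delete⇒∉ {C = C} y∉ x≢y y∈ = y∉ (Subset.x∈p∧x≢y⇒x∈p-y y∈ (x≢y ∘ sym))

x∉p-x : ∀ {n} (C : Subset n) x → x ∉ C - x
x∉p-x (c ∷ C) zero ()
x∉p-x (c ∷ C) (suc x) (there i) = x∉p-x C x i

-- A path avoiding `C - e` can meet `C` only in `e`, so it avoids `C` up to the first occurrence of
-- `e`; `lastUse` treats the rest after the last occurrence.
firstUse : ∀ {G u v} (C : Subset (nE G)) e (p : Path G u v) → avoids (C - e) p →
           avoids C p ⊎ Σ[ q ∈ Path G u (src G e) ] avoids C q
firstUse C e [] _ = inj₁ []
firstUse {G} C e (f ∷ (refl , p)) (a ∷ ap) with e ≟ f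
... | yes refl = inj₂ ([] , [])
... | no e≢f with firstUse C e p ap
...   | inj₁ aC = inj₁ (∉-delete⇒∉ a e≢f ∷ aC)
...   | inj₂ (q , aq) = inj₂ (f ∷ (refl , q) , ∉-delete⇒∉ a e≢f ∷ aq)

lastUse : ∀ {G u v} (C : Subset (nE G)) e (p : Path G u v) → avoids (C - e) p →
          avoids C p ⊎ Σ[ q ∈ Path G (tgt G e) v ] avoids C q
lastUse C e [] _ = inj₁ []
lastUse {G} C e (f ∷ (refl , p)) (a ∷ ap) with lastUse C e p ap
... | inj₂ h = inj₂ h
... | inj₁ aC with e ≟ f
...   | yes refl = inj₂ (p , aC)
...   | no e≢f = inj₁ (∉-delete⇒∉ a e≢f ∷ aC)

-- By minimality `C - e` is not a cut, and a path escaping it must use `e`; its outer pieces are the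
-- two paths wanted. The double negation remains because not being a cut does not exhibit a path.
minimalCut-ends : ∀ {G C e} → IsMinimalCut G C → e ∈ C →
                  ¬ ¬ ((Σ[ p ∈ Path G (s G) (src G e) ] avoids C p) × (Σ[ q ∈ Path G (tgt G e) (t G) ] avoids C q))
minimalCut-ends {G} {C} {e} (cut , min) e∈C k =
  x∉p-x C e (min (C - e) (Subset.p─q⊆p C ⁅ e ⁆) cut′ e∈C)
  where
  cut′ : IsCut G (C - e)
  cut′ p a with firstUse C e p a | lastUse C e p a
  ... | inj₁ aC | _ = cut p aC
  ... | inj₂ _ | inj₁ aC = cut p aC
  ... | inj₂ h | inj₂ h′ = k (h , h′)

serial-order : ∀ {G u v e f} (p : Path G u v) → e ∈ₑ p → f ∈ₑ p → e ≢ f →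
               Path G (tgt G e) (src G f) ⊎ Path G (tgt G f) (src G e)
serial-order (_ ∷ (_ , p)) (here refl) (here refl) e≢f = contradiction refl e≢f
serial-order (_ ∷ (_ , p)) (here refl) (there j) _ = inj₁ (before p j)
serial-order (_ ∷ (_ , p)) (there i) (here refl) _ = inj₂ (before p i)
serial-order (_ ∷ (_ , p)) (there i) (there j) e≢f = serial-order p i j e≢f

-- If `e` precedes `f` on a path, take `A` from `s` to the start of `f` and `B` from the end of `e`
-- to `t`, both off the cut. A common vertex would join them to an s-t path off the cut.
¬bad⇒SP≤1 : ∀ {G} → ¬ Bad G → ∀ S → IsSerial G S → IsParallel G S → ∣ S ∣ ≤ 1
¬bad⇒SP≤1 {G} ¬bad S (p , _ , S⊆p) (C , min , S⊆C) = ℕ.≮⇒≥ λ 2≤ → large (2≤∣∣⇒≢∈ S 2≤)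
  where
  ordered : ∀ {e f} → e ∈ S → f ∈ S → Path G (tgt G e) (src G f) → ⊥
  ordered e∈S f∈S M = minimalCut-ends min (S⊆C e∈S) λ { (_ , B , aB) →
    minimalCut-ends min (S⊆C f∈S) λ { ((A , aA) , _) →
    ¬bad (bridge A B M λ i j →
      let A′ , _ , A′⊆A = prefix A i
          B′ , _ , B′⊆B = suffix B j
      in proj₁ min (A′ ⧺ B′) (avoids-⧺ A′ B′ (All.tabulate (All.lookup aA ∘ A′⊆A)) (All.tabulate (All.lookup aB ∘ B′⊆B)))) } }
  large : ∃[ e ] ∃[ f ] e ∈ S × f ∈ S × e ≢ f → ⊥
  large (e , f , e∈S , f∈S , e≢f) with serial-order p (S⊆p e e∈S) (S⊆p f f∈S) e≢f
  ... | inj₁ M = ordered e∈S f∈S M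
  ... | inj₂ M = ordered f∈S e∈S M

-- The cut consists of all edges entering `t`, the boundary of the set of all other vertices; the
-- singleton is the last edge of an s-t path.
SP-singleton : ∀ {G} → Flow G → Σ[ S ∈ Subset (nE G) ] IsSerial G S × IsParallel G S × ∣ S ∣ ≡ 1
SP-singleton {G} fl with lastEdge (Flow.to fl (s G)) (Flow.s≢t fl)
... | e , i , tgt≡t = ⁅ e ⁆ ,
    (p , simple p , λ f f∈ → subst (_∈ₑ p) (sym (Subset.x∈⁅y⁆⇒x≡y e f∈)) i) ,
    (_ , boundary-minimal X? s≢t (λ t≢t → t≢t refl) ends ,
      λ f∈ → subst (_∈ _) (sym (Subset.x∈⁅y⁆⇒x≡y e f∈)) (∈-subset⁺ C? (t-sink e , λ ≢t → ≢t tgt≡t))) ,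
    Subset.∣⁅x⁆∣≡1 e
  where
  open Flow fl
  p : Path G (s G) (t G)
  p = to (s G)
  X? : Decidable (_≢ t G)
  X? v = ¬? (v ≟ t G)
  C? : Decidable (λ f → src G f ≢ t G × ¬ (tgt G f ≢ t G))
  C? f = X? (src G f) ×-dec ¬? (X? (tgt G f))
  ends : ∀ f → src G f ≢ t G → ¬ (tgt G f ≢ t G) →
         (Σ[ p ∈ Path G (s G) (src G f) ] (∀ {v} → v ∈ᵥ p → v ≢ t G)) ×
         (Σ[ q ∈ Path G (tgt G f) (t G) ] (∀ {v} → v ∈ᵥ q → ¬ (v ≢ t G)))
  ends f _ ¬≢t with decidable-stable (tgt G f ≟ t G) ¬≢t
  ... | eq = (from (src G f) , λ { j refl → t-sink f (sym (sink-path t-sink (proj₁ (suffix (from (src G f)) j)))) }) ,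
             subst (λ v → Σ[ q ∈ Path G v (t G) ] (∀ {w} → w ∈ᵥ q → ¬ (w ≢ t G))) (sym eq)
               ([] , λ { (here refl) ≢t → ≢t refl })

SPW≡1 : ∀ {G} → Flow G → ¬ Bad G → SPW≡ G 1
SPW≡1 fl ¬bad = SP-singleton fl , ¬bad⇒SP≤1 ¬bad

-- Subgraphs

-- Vertices and edges of a `Graph` are initial segments `Fin n`, so a subset has to be renumbered
-- before it can serve in a subgraph.
record Restriction {n} (P : Fin n → Set) : Set where
  field
    {size} : ℕ
    ι : Fin size → Fin n
    injective : Injective _≡_ _≡_ ι
    holds : ∀ i → P (ι i)
    index : ∀ {x} → P x → ∃[ i ] ι i ≡ x

restrict : ∀ {n} {P : Fin n → Set} → Decidable P → Restriction P
restrict {zero} P? = record { size = 0 ; ι = λ () ; injective = λ { {()} } ; holds = λ () ; index = λ { {()} } }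
restrict {suc n} {P} P? with P? zero | restrict (P? ∘ suc)
... | yes P₀ | r = record
  { ι = ι′ ; injective = inj
  ; holds = λ { zero → P₀ ; (suc i) → holds i }
  ; index = λ { {zero} _ → zero , refl ; {suc x} Px → let i , eq = index Px in suc i , cong suc eq } }
  where
  open Restriction r
  ι′ : Fin (suc size) → Fin (suc n)
  ι′ zero = zero
  ι′ (suc i) = suc (ι i)
  inj : Injective _≡_ _≡_ ι′
  inj {zero} {zero} _ = refl
  inj {suc i} {suc j} eq = cong suc (injective (suc-injective eq))
... | no ¬P₀ | r = record
  { ι = suc ∘ ι ; injective = injective ∘ suc-injective
  ; holds = holds
  ; index = λ { {zero} Px → contradiction Px ¬P₀ ; {suc x} Px → let i , eq = index Px in i , cong suc eq } }
  where open Restriction r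

missing⇒< : ∀ {m n} {f : Fin m → Fin n} → Injective _≡_ _≡_ f → ∀ x → (∀ i → f i ≢ x) → m < n
missing⇒< {n = suc n} {f} inj x miss =
  s≤s (injective⇒≤ {f = λ i → punchOut (miss i ∘ sym)} (inj ∘ punchOut-injective (miss _ ∘ sym) (miss _ ∘ sym)))

record Subgraph (G : Graph) (PV : V G → Set) (PE : E G → Set) (x y : V G) : Set where
  field
    H : Graph
    fV : V H → V G
    fE : E H → E G
    fV-inj : Injective _≡_ _≡_ fV
    fE-inj : Injective _≡_ _≡_ fE
    V-holds : ∀ v → PV (fV v)
    E-holds : ∀ e → PE (fE e)
    V-index : ∀ {v} → PV v → ∃[ v′ ] fV v′ ≡ v
    E-index : ∀ {e} → PE e → ∃[ e′ ] fE e′ ≡ e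
    src-hom : ∀ e → src G (fE e) ≡ fV (src H e)
    tgt-hom : ∀ e → tgt G (fE e) ≡ fV (tgt H e)
    s-hom : fV (s H) ≡ x
    t-hom : fV (t H) ≡ y

  pushPath : ∀ {u v} → Path H u v → Path G (fV u) (fV v)
  pushPath p = mapPath fV p (λ {e} _ → edge-on (fE e) (src-hom e) (tgt-hom e))

  liftPath : ∀ {u v u′ v′} (p : Path G u v) → (∀ {e} → e ∈ₑ p → PE e) → fV u′ ≡ u → fV v′ ≡ v → Lift H fV p u′ v′
  liftPath [] all eq eq′ with fV-inj (trans eq (sym eq′))
  ... | refl = lift-[] [] (here eq)
  liftPath (e ∷ (refl , p)) all eq eq′ with E-index (all (here refl))
  ... | e′ , refl with fV-inj (trans eq (src-hom e′))
  ...   | refl = lift-∷ e′ eq (liftPath p (all ∘ there) (sym (tgt-hom e′)) eq′)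

  smaller : ∀ e → ¬ PE e → nE H < nE G
  smaller e ¬Pe = missing⇒< fE-inj e λ i eq → ¬Pe (subst PE eq (E-holds i))

  embBridge : Bad H → Bridge G (fV (s H)) (fV (t H))
  embBridge = bad-embed fV fE fV-inj src-hom tgt-hom

  subBridge : Bad H → Bridge G x y
  subBridge br = subst₂ (Bridge G) s-hom t-hom (embBridge br)

  subFlow : Flow G → x ≢ y →
            (∀ v → PV v → Σ[ p ∈ Path G x v ] (∀ {e} → e ∈ₑ p → PE e)) →
            (∀ v → PV v → Σ[ p ∈ Path G v y ] (∀ {e} → e ∈ₑ p → PE e)) → Flow H
  subFlow fl x≢y from to = record
    { acyclic = λ e p → Flow.acyclic fl (fE e)
        (subst₂ (Path G) (sym (tgt-hom e)) (sym (src-hom e)) (pushPath p))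
    ; s≢t = λ eq → x≢y (trans (sym s-hom) (trans (cong fV eq) t-hom))
    ; from = λ v → let p , all = from (fV v) (V-holds v) in Lift.path (liftPath p all s-hom refl)
    ; to = λ v → let p , all = to (fV v) (V-holds v) in Lift.path (liftPath p all refl t-hom) }

subgraph : ∀ {G} {PV : V G → Set} {PE : E G → Set} {x y} → Decidable PV → Decidable PE →
           (∀ {e} → PE e → PV (src G e)) → (∀ {e} → PE e → PV (tgt G e)) → PV x → PV y → Subgraph G PV PE x y
subgraph {G} {PV} {PE} PV? PE? src-closed tgt-closed Px Py = record
  { H = record
      { nV = RV.size ; nE = RE.size
      ; src = λ e → proj₁ (RV.index (src-closed (RE.holds e)))
      ; tgt = λ e → proj₁ (RV.index (tgt-closed (RE.holds e)))
      ; s = proj₁ (RV.index Px) ; t = proj₁ (RV.index Py) }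
  ; fV = RV.ι ; fE = RE.ι ; fV-inj = RV.injective ; fE-inj = RE.injective
  ; V-holds = RV.holds ; E-holds = RE.holds ; V-index = RV.index ; E-index = RE.index
  ; src-hom = λ e → sym (proj₂ (RV.index (src-closed (RE.holds e))))
  ; tgt-hom = λ e → sym (proj₂ (RV.index (tgt-closed (RE.holds e))))
  ; s-hom = proj₂ (RV.index Px) ; t-hom = proj₂ (RV.index Py) }
  where
  module RV = Restriction (restrict PV?)
  module RE = Restriction (restrict PE?)

subgraphs-embed : ∀ {G PV₁ PV₂ PE₁ PE₂ x₁ y₁ x₂ y₂}
  (S₁ : Subgraph G PV₁ PE₁ x₁ y₁) (S₂ : Subgraph G PV₂ PE₂ x₂ y₂) →
  (∀ v → PV₁ v ⊎ PV₂ v) → (∀ e → PE₁ e ⊎ PE₂ e) → (∀ e → PE₁ e → ¬ PE₂ e) →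
  Embedding2 (Subgraph.H S₁) (Subgraph.H S₂) G
subgraphs-embed {PE₂ = PE₂} S₁ S₂ V-cov E-cov E-dis = record
  { fV₁ = S₁.fV ; fV₂ = S₂.fV ; fE₁ = S₁.fE ; fE₂ = S₂.fE
  ; fV₁-inj = S₁.fV-inj ; fV₂-inj = S₂.fV-inj ; fE₁-inj = S₁.fE-inj ; fE₂-inj = S₂.fE-inj
  ; src₁ = S₁.src-hom ; tgt₁ = S₁.tgt-hom ; src₂ = S₂.src-hom ; tgt₂ = S₂.tgt-hom
  ; V-cover = λ v → [ inj₁ ∘ S₁.V-index , inj₂ ∘ S₂.V-index ]′ (V-cov v)
  ; E-cover = λ e → [ inj₁ ∘ S₁.E-index , inj₂ ∘ S₂.E-index ]′ (E-cov e)
  ; E-disj = λ e₁ e₂ eq → E-dis _ (S₁.E-holds e₁) (subst PE₂ (sym eq) (S₂.E-holds e₂)) }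
  where
  module S₁ = Subgraph S₁
  module S₂ = Subgraph S₂

subgraphs-parallel : ∀ {G PV₁ PV₂ PE₁ PE₂}
  (S₁ : Subgraph G PV₁ PE₁ (s G) (t G)) (S₂ : Subgraph G PV₂ PE₂ (s G) (t G)) →
  (∀ v → PV₁ v ⊎ PV₂ v) → (∀ e → PE₁ e ⊎ PE₂ e) → (∀ e → PE₁ e → ¬ PE₂ e) →
  (∀ v → PV₁ v → PV₂ v → v ≡ s G ⊎ v ≡ t G) → ParallelComp (Subgraph.H S₁) (Subgraph.H S₂) G
subgraphs-parallel {PV₁ = PV₁} {PV₂} S₁ S₂ V-cov E-cov E-dis shared = record
  { emb = subgraphs-embed S₁ S₂ V-cov E-cov E-dis
  ; glue = λ v₁ v₂ eq → [ (λ is → inj₁ (S₁.fV-inj (trans is (sym S₁.s-hom)) , S₂.fV-inj (trans (sym eq) (trans is (sym S₂.s-hom)))))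
                        , (λ is → inj₂ (S₁.fV-inj (trans is (sym S₁.t-hom)) , S₂.fV-inj (trans (sym eq) (trans is (sym S₂.t-hom))))) ]′
                        (shared _ (S₁.V-holds v₁) (subst PV₂ (sym eq) (S₂.V-holds v₂)))
  ; glued-s = trans S₁.s-hom (sym S₂.s-hom)
  ; glued-t = trans S₁.t-hom (sym S₂.t-hom)
  ; s-is = sym S₁.s-hom
  ; t-is = sym S₁.t-hom }
  where
  module S₁ = Subgraph S₁
  module S₂ = Subgraph S₂

subgraphs-serial : ∀ {G PV₁ PV₂ PE₁ PE₂ m}
  (S₁ : Subgraph G PV₁ PE₁ (s G) m) (S₂ : Subgraph G PV₂ PE₂ m (t G)) →
  (∀ v → PV₁ v ⊎ PV₂ v) → (∀ e → PE₁ e ⊎ PE₂ e) → (∀ e → PE₁ e → ¬ PE₂ e) →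
  (∀ v → PV₁ v → PV₂ v → v ≡ m) → SerialComp (Subgraph.H S₁) (Subgraph.H S₂) G
subgraphs-serial {PV₂ = PV₂} S₁ S₂ V-cov E-cov E-dis shared = record
  { emb = subgraphs-embed S₁ S₂ V-cov E-cov E-dis
  ; glue = λ v₁ v₂ eq → let is = shared _ (S₁.V-holds v₁) (subst PV₂ (sym eq) (S₂.V-holds v₂)) in
                        S₁.fV-inj (trans is (sym S₁.t-hom)) , S₂.fV-inj (trans (sym eq) (trans is (sym S₂.s-hom)))
  ; glued = trans S₁.t-hom (sym S₂.s-hom)
  ; s-is = sym S₁.s-hom
  ; t-is = sym S₂.t-hom }
  where
  module S₁ = Subgraph S₁
  module S₂ = Subgraph S₂

-- Decomposition at a pivot

-- Reachability by a nonempty path. Acyclicity makes it a strict order, and finiteness makes it well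
-- founded in both directions, which drives the choice of the pivot.
_⊢_⊏_ : (G : Graph) → V G → V G → Set
G ⊢ u ⊏ v = Σ[ e ∈ E G ] Path G u (src G e) × Path G (tgt G e) v

⊏-isStrictPartialOrder : ∀ {G} → Flow G → IsStrictPartialOrder _≡_ (G ⊢_⊏_)
⊏-isStrictPartialOrder {G} fl = record
  { isEquivalence = isEquivalence
  ; irrefl = λ { refl (e , p , q) → Flow.acyclic fl e (q ⧺ p) }
  ; trans = λ { (e , p , q) (f , p′ , q′) → e , p , q ⧺ (p′ ⧺ (edge f ⧺ q′)) }
  ; <-resp-≈ = resp₂ (G ⊢_⊏_) }

-- A search along outgoing edges, which terminates because each edge ascends in the order.
reach? : ∀ {G} → Flow G → ∀ u v → Dec (Path G u v)
reach? {G} fl u v = go u (spo-noetherian (⊏-isStrictPartialOrder fl) u)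
  where
  go : ∀ u → Acc (flip (G ⊢_⊏_)) u → Dec (Path G u v)
  go u (acc rec) with u ≟ v
  ... | yes refl = yes []
  ... | no u≢v = map′ (λ { (e , eq , p) → e ∷ (eq , p) })
                      (λ { [] → contradiction refl u≢v ; (e ∷ (eq , p)) → e , eq , p }) (any? next?)
    where
    next? : Decidable (λ e → src G e ≡ u × Path G (tgt G e) v)
    next? e with src G e ≟ u
    ... | no neq = no (neq ∘ proj₁)
    ... | yes refl = map′ (refl ,_) proj₂ (go (tgt G e) (rec (e , [] , [])))

-- With no bridge, the first vertex of a branch leaving for t lies on every
-- path from s to a vertex that the branch itself no longer reaches.
¬bad⇒dominates : ∀ {G} → ¬ Bad G → ∀ e {y} (A : Path G (s G) y) → Path G (src G e) y →
                 ¬ Path G (tgt G e) y → Path G (tgt G e) (t G) → ¬ ¬ (src G e ∈ᵥ A)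
¬bad⇒dominates ¬bad e A M ¬p q k = ¬bad (bridge A (e ∷ (refl , q)) M
  λ { i (here refl) → k i ; i (there j) → ¬p (proj₁ (prefix q j) ⧺ proj₁ (suffix A i)) })

-- Together: the edges on no path through m form a part of G attached to the
-- rest only at s and t.
NoEscape NoIntrusion : (G : Graph) → V G → Set
NoEscape G m = ∀ e → Path G (src G e) m → ¬ Path G (tgt G e) m → ¬ Path G m (src G e) → src G e ≡ s G
NoIntrusion G m = ∀ e → Path G m (tgt G e) → ¬ Path G m (src G e) → ¬ Path G (tgt G e) m → tgt G e ≡ t G

Internal : (G : Graph) → V G → Set
Internal G v = v ≢ s G × v ≢ t G

record Pivot (G : Graph) : Set where
  field
    m : V G
    internal : Internal G m
    noEscape : NoEscape G m
    noIntrusion : NoIntrusion G m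

-- Descend along incoming edges until all of them start in `s`. Then `s` is the only vertex besides
-- `m` that reaches `m`.
minimal-noEscape : ∀ {G} → Flow G → ∀ v → Internal G v → Σ[ m ∈ V G ] Internal G m × NoEscape G m
minimal-noEscape {G} fl v = go v (spo-wellFounded (⊏-isStrictPartialOrder fl) v)
  where
  open Flow fl
  go : ∀ v → Acc (G ⊢_⊏_) v → Internal G v → Σ[ m ∈ V G ] Internal G m × NoEscape G m
  go v (acc rec) int with any? (λ e → (tgt G e ≟ v) ×-dec ¬? (src G e ≟ s G))
  ... | yes (e , refl , src≢s) = go (src G e) (rec (e , [] , [])) (src≢s , t-sink e)
  ... | no none = v , int , λ e p _ ¬q → from-s p (λ { refl → ¬q [] })
    where
    from-s : ∀ {u} → Path G u v → u ≢ v → u ≡ s G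
    from-s p u≢v with lastEdge p u≢v
    ... | f , i , eq with decidable-stable (src G f ≟ s G) (λ ≢s → none (f , eq , ≢s))
    ...   | eq′ = source-path s-source (subst (Path G _) eq′ (before p i))

-- An intrusion e into {v | m →* v} moves the pivot from m up to tgt e; an
-- escape from the new pivot would already be an escape from m.
pivot : ∀ {G} → Flow G → ¬ Bad G → ∀ v → Internal G v → Pivot G
pivot {G} fl ¬bad v int₀ with minimal-noEscape fl v int₀
... | m₀ , int , ne = climb m₀ (spo-noetherian (⊏-isStrictPartialOrder fl) m₀) int ne
  where
  open Flow fl
  climb : ∀ m → Acc (flip (G ⊢_⊏_)) m → Internal G m → NoEscape G m → Pivot G
  climb m (acc rec) int ne with any? (λ e → reach? fl m (tgt G e) ×-dec ¬? (reach? fl m (src G e)) ×-dec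
                                           ¬? (reach? fl (tgt G e) m) ×-dec ¬? (tgt G e ≟ t G))
  ... | no none = record { m = m ; internal = int ; noEscape = ne
                         ; noIntrusion = λ e p ¬q ¬r → decidable-stable (tgt G e ≟ t G) λ ≢t → none (e , p , ¬q , ¬r , ≢t) }
  ... | yes (e , m→y , m↛x , y↛m , y≢t) = climb (tgt G e) (rec m⊏y) (s-source e , y≢t) noEscape′
    where
    m⊏y : G ⊢ m ⊏ tgt G e
    m⊏y with firstEdge m→y (λ { refl → y↛m [] })
    ... | f , i , refl = f , [] , after m→y i
    noEscape′ : NoEscape G (tgt G e)
    -- The start x′ of the escape `f` dominates the new pivot y, in the doubly negated sense. On the
    -- path through `e` it must come before y, so x′ reaches the start of `e` and `m` cannot reach
    -- x′. On the path through `m` it therefore comes before `m`, and `f` is an escape from `m`.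
    noEscape′ f x′→y y′↛y y↛x′ = decidable-stable (src G f ≟ s G) λ x′≢s →
      dom (from (src G e) ⧺ edge e) λ on₁ → dom (from m ⧺ m→y) λ on₂ →
      let m↛x′ : ¬ Path G m (src G f)
          m↛x′ p = m↛x (p ⧺ [ (λ i → proj₁ (suffix (from (src G e)) i))
                            , (λ { (here eq) → subst (Path G (src G f)) eq [] ; (there (here eq)) → contradiction (subst (λ v → Path G v (src G f)) eq []) y↛x′ }) ]′ (∈ᵥ-⧺⁻ (from (src G e)) _ on₁))
          x′→m : Path G (src G f) m
          x′→m = [ (λ i → proj₁ (suffix (from m) i)) , (λ i → contradiction (proj₁ (prefix m→y i)) m↛x′) ]′ (∈ᵥ-⧺⁻ (from m) _ on₂)
      in x′≢s (ne f x′→m (λ p → y′↛y (p ⧺ m→y)) m↛x′)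
      where
      dom : (A : Path G (s G) (tgt G e)) → ¬ ¬ (src G f ∈ᵥ A)
      dom A = ¬bad⇒dominates ¬bad f A x′→y y′↛y (to (tgt G f))

-- A vertex shared by `A` and the extension `q` would lie both before and after `m`, hence be `m`,
-- which already belongs to `B`.
bridge-extendʳ : ∀ {G x m y} → Flow G → (br : Bridge G x m) → Path G (Bridge.b br) m → Path G m y → Bridge G x y
bridge-extendʳ fl (bridge A B M dis) b→m q = bridge A (B ⧺ q) M λ i j →
  [ dis i , (λ k → dis i (subst (_∈ᵥ B) (Flow.antisym fl (proj₁ (prefix q k)) (proj₁ (suffix A i) ⧺ b→m)) (end∈ B))) ]′ (∈ᵥ-⧺⁻ B _ j)

bridge-extendˡ : ∀ {G x m y} → Flow G → (br : Bridge G m y) → Path G m (Bridge.a br) → Path G x m → Bridge G x y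
bridge-extendˡ fl (bridge A B M dis) m→a q = bridge (q ⧺ A) B M λ i j →
  [ (λ k → dis (subst (_∈ᵥ A) (Flow.antisym fl (m→a ⧺ proj₁ (prefix B j)) (proj₁ (suffix q k))) (start∈ A)) j) , (λ k → dis k j) ]′ (∈ᵥ-⧺⁻ q _ i)

edge-closed : ∀ {G u v} {P : E G → Set} (p : Path G u v) →
              (∀ e → Path G u (src G e) → Path G (tgt G e) v → P e) → ∀ {e} → e ∈ₑ p → P e
edge-closed p h {e} i = h e (before p i) (after p i)

-- The parts have other terminals than `G`, so a bridge in one of them becomes a bridge of `G` only
-- after one side path is prolonged from `m` to `t` or back from `m` to `s`. Each part is smaller,
-- as it lacks the edges on the other side of `m`.
pivot-serial : ∀ {G} → Flow G → ¬ Bad G → (pv : Pivot G) → let open Pivot pv in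
               (∀ e → Path G (tgt G e) m ⊎ Path G m (src G e)) →
               (∀ H → nE H < nE G → Flow H → ¬ Bad H → IsSP H) → IsSP G
pivot-serial {G} fl ¬bad pv cover rec =
  serial (rec S₁.H size₁ flow₁ λ br → ¬bad (subst (λ v → Bridge G v (t G)) S₁.s-hom
           (bridge-extendʳ fl (S₁.embBridge br) (S₁.pushPath (Flow.to flow₁ (Bridge.b br))) (to _))))
         (rec S₂.H size₂ flow₂ λ br → ¬bad (subst (Bridge G (s G)) S₂.t-hom
           (bridge-extendˡ fl (S₂.embBridge br) (S₂.pushPath (Flow.from flow₂ (Bridge.a br))) (from _))))
         (subgraphs-serial S₁ S₂ V-cover′ cover disj λ v p q → antisym p q)
  where
  open Flow fl
  open Pivot pv
  disj : ∀ e → Path G (tgt G e) m → ¬ Path G m (src G e)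
  disj e p q = acyclic e (p ⧺ q)
  S₁ : Subgraph G (λ v → Path G v m) (λ e → Path G (tgt G e) m) (s G) m
  S₁ = subgraph (λ v → reach? fl v m) (λ e → reach? fl (tgt G e) m) (λ {e} p → e ∷ (refl , p)) id (from m) []
  S₂ : Subgraph G (λ v → Path G m v) (λ e → Path G m (src G e)) m (t G)
  S₂ = subgraph (λ v → reach? fl m v) (λ e → reach? fl m (src G e)) id (λ {e} p → p ⧺ edge e) [] (to m)
  module S₁ = Subgraph S₁
  module S₂ = Subgraph S₂
  V-cover′ : ∀ v → Path G v m ⊎ Path G m v
  V-cover′ v with v ≟ s G
  ... | yes refl = inj₁ (from m)
  ... | no v≢s with lastEdge (from v) (v≢s ∘ sym)
  ...   | e , _ , refl = [ inj₁ , (λ p → inj₂ (p ⧺ edge e)) ]′ (cover e)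
  size₁ : nE S₁.H < nE G
  size₁ with firstEdge (to m) (proj₂ internal)
  ... | e , _ , refl = S₁.smaller e (acyclic e)
  size₂ : nE S₂.H < nE G
  size₂ with lastEdge (from m) (proj₁ internal ∘ sym)
  ... | e , _ , refl = S₂.smaller e (acyclic e)
  flow₁ : Flow S₁.H
  flow₁ = S₁.subFlow fl (proj₁ internal ∘ sym)
    (λ v p → from v , edge-closed (from v) (λ e _ q → q ⧺ p)) (λ v p → p , edge-closed p (λ e _ q → q))
  flow₂ : Flow S₂.H
  flow₂ = S₂.subFlow fl (proj₂ internal)
    (λ v p → p , edge-closed p (λ e q _ → q)) (λ v p → to v , edge-closed (to v) (λ e q _ → p ⧺ q))

sub-¬bad : ∀ {G PV PE} (S : Subgraph G PV PE (s G) (t G)) → ¬ Bad G → ¬ Bad (Subgraph.H S)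
sub-¬bad S ¬bad br = ¬bad (Subgraph.subBridge S br)

-- By the two pivot conditions, an end of an edge outside the first part is a terminal or
-- incomparable with `m`, so the parts share only `s` and `t`. The edge `e₀` makes the first part
-- smaller than `G` and connects the terminals of the second.
pivot-parallel : ∀ {G} → Flow G → ¬ Bad G → (pv : Pivot G) → let open Pivot pv in
                 ∀ e₀ → ¬ Path G (tgt G e₀) m → ¬ Path G m (src G e₀) →
                 (∀ H → nE H < nE G → Flow H → ¬ Bad H → IsSP H) → IsSP G
pivot-parallel {G} fl ¬bad pv e₀ ¬p₀ ¬q₀ rec =
  parallel (rec S₁.H (S₁.smaller e₀ [ ¬p₀ , ¬q₀ ]′) flow₁ (sub-¬bad S₁ ¬bad))
           (rec S₂.H size₂ flow₂ (sub-¬bad S₂ ¬bad))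
           (subgraphs-parallel S₁ S₂ V-cov E-cov (λ e → λ { (inj₁ p) (¬p , _) → ¬p p ; (inj₂ q) (_ , ¬q) → ¬q q })
             (λ v → λ { _ (inj₁ is-s) → inj₁ is-s ; _ (inj₂ (inj₁ is-t)) → inj₂ is-t
                      ; (inj₁ p) (inj₂ (inj₂ (¬p , _))) → contradiction p ¬p
                      ; (inj₂ q) (inj₂ (inj₂ (_ , ¬q))) → contradiction q ¬q }))
  where
  open Flow fl
  open Pivot pv
  V₁ V₂ : V G → Set
  V₁ v = Path G v m ⊎ Path G m v
  V₂ v = v ≡ s G ⊎ v ≡ t G ⊎ (¬ Path G v m × ¬ Path G m v)
  E₁ E₂ : E G → Set
  E₁ e = Path G (tgt G e) m ⊎ Path G m (src G e)
  E₂ e = ¬ Path G (tgt G e) m × ¬ Path G m (src G e)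
  S₁ : Subgraph G V₁ E₁ (s G) (t G)
  S₁ = subgraph (λ v → reach? fl v m ⊎-dec reach? fl m v) (λ e → reach? fl (tgt G e) m ⊎-dec reach? fl m (src G e))
         (λ {e} → [ (λ p → inj₁ (e ∷ (refl , p))) , inj₂ ]′) (λ {e} → [ inj₁ , (λ p → inj₂ (p ⧺ edge e)) ]′)
         (inj₁ (from m)) (inj₂ (to m))
  S₂ : Subgraph G V₂ E₂ (s G) (t G)
  S₂ = subgraph (λ v → (v ≟ s G) ⊎-dec (v ≟ t G) ⊎-dec (¬? (reach? fl v m) ×-dec ¬? (reach? fl m v)))
         (λ e → ¬? (reach? fl (tgt G e) m) ×-dec ¬? (reach? fl m (src G e)))
         src-closed tgt-closed (inj₁ refl) (inj₂ (inj₁ refl))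
    where
    src-closed : ∀ {e} → E₂ e → V₂ (src G e)
    src-closed {e} (¬p , ¬q) with reach? fl (src G e) m
    ... | yes r = inj₁ (noEscape e r ¬p ¬q)
    ... | no ¬r = inj₂ (inj₂ (¬r , ¬q))
    tgt-closed : ∀ {e} → E₂ e → V₂ (tgt G e)
    tgt-closed {e} (¬p , ¬q) with reach? fl m (tgt G e)
    ... | yes r = inj₂ (inj₁ (noIntrusion e r ¬q ¬p))
    ... | no ¬r = inj₂ (inj₂ (¬p , ¬r))
  module S₁ = Subgraph S₁
  module S₂ = Subgraph S₂
  E-cov : ∀ e → E₁ e ⊎ E₂ e
  E-cov e with reach? fl (tgt G e) m | reach? fl m (src G e)
  ... | yes p | _ = inj₁ (inj₁ p)
  ... | no _ | yes q = inj₁ (inj₂ q)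
  ... | no ¬p | no ¬q = inj₂ (¬p , ¬q)
  V-cov : ∀ v → V₁ v ⊎ V₂ v
  V-cov v with reach? fl v m | reach? fl m v
  ... | yes p | _ = inj₁ (inj₁ p)
  ... | no _ | yes q = inj₁ (inj₂ q)
  ... | no ¬p | no ¬q = inj₂ (inj₂ (inj₂ (¬p , ¬q)))
  size₂ : nE S₂.H < nE G
  size₂ with lastEdge (from m) (proj₁ internal ∘ sym)
  ... | e , _ , refl = S₂.smaller e λ (¬p , _) → ¬p []
  flow₁ : Flow S₁.H
  flow₁ = S₁.subFlow fl s≢t from₁ to₁
    where
    from₁ : ∀ v → V₁ v → Σ[ p ∈ Path G (s G) v ] (∀ {e} → e ∈ₑ p → E₁ e)
    from₁ v (inj₁ p) = from v , edge-closed {P = E₁} (from v) (λ e _ q → inj₁ (q ⧺ p))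
    from₁ v (inj₂ p) = from m ⧺ p , λ i → [ edge-closed {P = E₁} (from m) (λ e _ q → inj₁ q)
                                          , edge-closed {P = E₁} p (λ e q _ → inj₂ q) ]′ (∈ₑ-⧺⁻ (from m) p i)
    to₁ : ∀ v → V₁ v → Σ[ p ∈ Path G v (t G) ] (∀ {e} → e ∈ₑ p → E₁ e)
    to₁ v (inj₂ p) = to v , edge-closed {P = E₁} (to v) (λ e q _ → inj₂ (p ⧺ q))
    to₁ v (inj₁ p) = p ⧺ to m , λ i → [ edge-closed {P = E₁} p (λ e _ q → inj₁ q)
                                      , edge-closed {P = E₁} (to m) (λ e q _ → inj₂ q) ]′ (∈ₑ-⧺⁻ p (to m) i)
  flow₂ : Flow S₂.H
  flow₂ = S₂.subFlow fl s≢t from₂ to₂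
    where
    fromQ : ∀ v → ¬ Path G m v → ∀ e → Path G (tgt G e) v → ¬ Path G v m → E₂ e
    fromQ v ¬q e r ¬p = ¬tgt , ¬src
      where
      ¬src : ¬ Path G m (src G e)
      ¬src q = ¬q (q ⧺ (e ∷ (refl , r)))
      ¬tgt : ¬ Path G (tgt G e) m
      -- If the end of `e` reached `m`, the path `r` would contain an escape, which starts in `s`;
      -- but nothing entered by an edge leads to `s`.
      ¬tgt p with crossing (λ x → reach? fl x m) r p ¬p
      ... | f , i , pf , ¬pf = s-source e (source-path s-source
              (subst (Path G _) (noEscape f pf ¬pf λ q → ¬q (q ⧺ (f ∷ (refl , after r i)))) (before r i)))
    toQ : ∀ v → ¬ Path G v m → ∀ e → Path G v (src G e) → ¬ Path G m v → E₂ e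
    toQ v ¬p e r ¬q = ¬tgt , ¬src
      where
      ¬tgt : ¬ Path G (tgt G e) m
      ¬tgt p = ¬p (r ⧺ (e ∷ (refl , p)))
      ¬src : ¬ Path G m (src G e)
      ¬src q with crossing (λ x → ¬? (reach? fl m x)) r ¬q (λ ¬q′ → ¬q′ q)
      ... | f , i , ¬qf , ¬¬qf = t-sink e (sym (sink-path t-sink
              (subst (λ v → Path G v _) (noIntrusion f (decidable-stable (reach? fl m (tgt G f)) ¬¬qf) ¬qf
                λ p → ¬p (before r i ⧺ (f ∷ (refl , p)))) (after r i))))
    P Q : V G → Set
    P v = Σ[ p ∈ Path G (s G) v ] (∀ {e} → e ∈ₑ p → E₂ e)
    Q v = Σ[ p ∈ Path G v (t G) ] (∀ {e} → e ∈ₑ p → E₂ e)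
    P₀ : P (src G e₀)
    P₀ with reach? fl (src G e₀) m
    ... | no ¬r = from _ , edge-closed (from _) λ e _ p → fromQ _ ¬q₀ e p ¬r
    ... | yes r = subst P (sym (noEscape e₀ r ¬p₀ ¬q₀)) ([] , λ ())
    Q₀ : Q (tgt G e₀)
    Q₀ with reach? fl m (tgt G e₀)
    ... | no ¬r = to _ , edge-closed (to _) λ e p _ → toQ _ ¬p₀ e p ¬r
    ... | yes r = subst Q (sym (noIntrusion e₀ r ¬q₀ ¬p₀)) ([] , λ ())
    -- This path inside the second part witnesses that its `s` reaches `t`, which `from` and `to`
    -- need not do with edges of `E₂`.
    through : Σ[ p ∈ Path G (s G) (t G) ] (∀ {e} → e ∈ₑ p → E₂ e)
    through = proj₁ P₀ ⧺ (e₀ ∷ (refl , proj₁ Q₀)) , λ i →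
      [ proj₂ P₀ , (λ { (here refl) → ¬p₀ , ¬q₀ ; (there j) → proj₂ Q₀ j }) ]′ (∈ₑ-⧺⁻ (proj₁ P₀) _ i)
    from₂ : ∀ v → V₂ v → P v
    from₂ v (inj₁ refl) = [] , λ ()
    from₂ v (inj₂ (inj₁ refl)) = through
    from₂ v (inj₂ (inj₂ (¬p , ¬q))) = from v , edge-closed (from v) λ e _ r → fromQ v ¬q e r ¬p
    to₂ : ∀ v → V₂ v → Q v
    to₂ v (inj₁ refl) = through
    to₂ v (inj₂ (inj₁ refl)) = [] , λ ()
    to₂ v (inj₂ (inj₂ (¬p , ¬q))) = to v , edge-closed (to v) λ e r _ → toQ v ¬p e r ¬q

-- Without inner vertices every edge runs from `s` to `t`. One edge is split off in parallel until a
-- single edge, a copy of `K₂`, is left.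
bundle-sp : ∀ {G} → Flow G → ¬ Bad G → (∀ v → v ≡ s G ⊎ v ≡ t G) →
            (∀ H → nE H < nE G → Flow H → ¬ Bad H → IsSP H) → IsSP G
bundle-sp {G} fl ¬bad ends rec with firstEdge (Flow.to fl (s G)) (Flow.s≢t fl)
... | e₀ , _ , _ with any? (λ e → ¬? (e ≟ e₀))
...   | yes (e₁ , e₁≢e₀) =
  parallel (rec S₁.H (S₁.smaller e₁ e₁≢e₀) (flow-on S₁ refl) (sub-¬bad S₁ ¬bad))
           (rec S₂.H (S₂.smaller e₀ (λ h → h refl)) (flow-on S₂ e₁≢e₀) (sub-¬bad S₂ ¬bad))
           (subgraphs-parallel S₁ S₂ (λ _ → inj₁ tt) E-cov (λ e p ¬p → ¬p p) (λ v _ _ → ends v))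
  where
  open Flow fl
  S₁ : Subgraph G (λ _ → ⊤) (_≡ e₀) (s G) (t G)
  S₁ = subgraph (λ _ → yes tt) (_≟ e₀) _ _ tt tt
  S₂ : Subgraph G (λ _ → ⊤) (_≢ e₀) (s G) (t G)
  S₂ = subgraph (λ _ → yes tt) (λ e → ¬? (e ≟ e₀)) _ _ tt tt
  module S₁ = Subgraph S₁
  module S₂ = Subgraph S₂
  E-cov : ∀ e → e ≡ e₀ ⊎ e ≢ e₀
  E-cov e with e ≟ e₀
  ... | yes eq = inj₁ eq
  ... | no neq = inj₂ neq
  flow-on : ∀ {PE e} (S : Subgraph G (λ _ → ⊤) PE (s G) (t G)) → PE e → Flow (Subgraph.H S)
  flow-on {PE} {e} S Pe = Subgraph.subFlow S fl s≢t from′ to′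
    where
    st : Path G (s G) (t G)
    st with ends (src G e) | ends (tgt G e)
    ... | inj₁ eq | inj₂ eq′ = edge-on e eq eq′
    ... | inj₂ eq | _ = contradiction eq (t-sink e)
    ... | inj₁ _ | inj₁ eq = contradiction eq (s-source e)
    st-e : ∀ {f} → f ∈ₑ st → PE f
    st-e i with ends (src G e) | ends (tgt G e)
    st-e i | inj₁ eq | inj₂ eq′ = subst PE (sym (edge-on-∈ₑ e eq eq′ i)) Pe
    st-e i | inj₂ eq | _ = contradiction eq (t-sink e)
    st-e i | inj₁ _ | inj₁ eq = contradiction eq (s-source e)
    from′ : ∀ v → ⊤ → Σ[ p ∈ Path G (s G) v ] (∀ {f} → f ∈ₑ p → PE f)
    from′ v _ with ends v
    ... | inj₁ refl = [] , λ ()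
    ... | inj₂ refl = st , st-e
    to′ : ∀ v → ⊤ → Σ[ p ∈ Path G v (t G) ] (∀ {f} → f ∈ₑ p → PE f)
    to′ v _ with ends v
    ... | inj₁ refl = st , st-e
    ... | inj₂ refl = [] , λ ()
...   | no none = single (record
  { fV = λ { zero → s G ; (suc _) → t G } ; fE = λ _ → e₀
  ; fV-bij = (λ { {zero} {zero} _ → refl ; {zero} {suc zero} eq → contradiction eq s≢t
                ; {suc zero} {zero} eq → contradiction (sym eq) s≢t ; {suc zero} {suc zero} _ → refl })
           , (λ v → [ (λ eq → zero , λ { refl → sym eq }) , (λ eq → suc zero , λ { refl → sym eq }) ]′ (ends v))
  ; fE-bij = (λ { {zero} {zero} _ → refl })
           , (λ e → zero , λ _ → sym (decidable-stable (e ≟ e₀) λ neq → none (e , neq)))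
  ; src-hom = λ _ → [ id , (λ eq → contradiction eq (t-sink e₀)) ]′ (ends (src G e₀))
  ; tgt-hom = λ _ → [ (λ eq → contradiction eq (s-source e₀)) , id ]′ (ends (tgt G e₀))
  ; s-hom = refl ; t-hom = refl })
  where open Flow fl

¬bad-sp : ∀ {G} → Flow G → ¬ Bad G → IsSP G
¬bad-sp {G} = go G (<-wellFounded (nE G))
  where
  go : ∀ G → Acc _<_ (nE G) → Flow G → ¬ Bad G → IsSP G
  go G (acc rec) fl ¬bad with any? (λ v → ¬? (v ≟ s G) ×-dec ¬? (v ≟ t G))
  ... | no none = bundle-sp fl ¬bad ends λ H lt → go H (rec lt)
    where
    ends : ∀ v → v ≡ s G ⊎ v ≡ t G
    ends v with v ≟ s G | v ≟ t G
    ... | yes eq | _ = inj₁ eq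
    ... | no _ | yes eq = inj₂ eq
    ... | no ≢s | no ≢t = contradiction (v , ≢s , ≢t) none
  ... | yes (v , int) with pivot fl ¬bad v int
  ...   | pv with any? (λ e → ¬? (reach? fl (tgt G e) (Pivot.m pv)) ×-dec ¬? (reach? fl (Pivot.m pv) (src G e)))
  ...     | yes (e₀ , ¬p , ¬q) = pivot-parallel fl ¬bad pv e₀ ¬p ¬q λ H lt → go H (rec lt)
  ...     | no none = pivot-serial fl ¬bad pv cover λ H lt → go H (rec lt)
    where
    open Pivot pv
    cover : ∀ e → Path G (tgt G e) m ⊎ Path G m (src G e)
    cover e with reach? fl (tgt G e) m | reach? fl m (src G e)
    ... | yes p | _ = inj₁ p
    ... | no _ | yes q = inj₂ q
    ... | no ¬p | no ¬q = contradiction (e , ¬p , ¬q) none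

-- Deletion and contraction

inEdge : ∀ {G u v x} (p : Path G u v) → x ∈ᵥ p → u ≢ x → Σ[ e ∈ E G ] e ∈ₑ p × tgt G e ≡ x
inEdge p i u≢x with prefix p i
... | q , _ , es with lastEdge q u≢x
...   | e , j , eq = e , es j , eq

outEdge : ∀ {G u v x} (p : Path G u v) → x ∈ᵥ p → x ≢ v → Σ[ e ∈ E G ] e ∈ₑ p × src G e ≡ x
outEdge p i x≢v with suffix p i
... | q , _ , es with firstEdge q x≢v
...   | e , j , eq = e , es j , eq

-- One Addition undoes the deletion of `e`. The steps end in a graph `K` that is only isomorphic to
-- the subgraph, so the ends of the new edge are pulled back to `K`.
dEmbedded-add : ∀ {G e} (S : Subgraph G (λ _ → ⊤) (_≢ e) (s G) (t G)) → ¬ Path G (tgt G e) (src G e) →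
                DEmbedded Braess (Subgraph.H S) → DEmbedded Braess G
dEmbedded-add {G} {e} S acyc (K , steps , iso) =
  addEdge K (proj₁ (fV-index (src G e))) (proj₁ (fV-index (tgt G e))) ,
  steps ◅◅ (addition K _ _ (λ p → acyc (subst₂ (Path G) (proj₂ (fV-index _)) (proj₂ (fV-index _)) (pushPath (isoPath p)))) ◅ ε) ,
  record
  { fV = fV ∘ I.fV
  ; fE = fE′
  ; fV-bij = (λ eq → proj₁ I.fV-bij (fV-inj eq)) , (λ v → let w , eq = fV-index v in w , λ { refl → eq })
  ; fE-bij = inj , (λ f → sur f (f ≟ e))
  ; src-hom = λ { zero → sym (proj₂ (fV-index _)) ; (suc j) → trans (src-hom _) (cong fV (I.src-hom j)) }
  ; tgt-hom = λ { zero → sym (proj₂ (fV-index _)) ; (suc j) → trans (tgt-hom _) (cong fV (I.tgt-hom j)) }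
  ; s-hom = trans (cong fV I.s-hom) s-hom
  ; t-hom = trans (cong fV I.t-hom) t-hom }
  where
  open Subgraph S
  module I = Iso iso
  fV-index : ∀ v → ∃[ w ] fV (I.fV w) ≡ v
  fV-index v with V-index {v} tt
  ... | w , eq with proj₂ I.fV-bij w
  ...   | w′ , eq′ = w′ , trans (cong fV (eq′ refl)) eq
  isoPath : ∀ {u v} → Path K u v → Path H (I.fV u) (I.fV v)
  isoPath p = mapPath I.fV p (λ {f} _ → edge-on (I.fE f) (I.src-hom f) (I.tgt-hom f))
  fE′ : Fin (suc (nE K)) → E G
  fE′ zero = e
  fE′ (suc j) = fE (I.fE j)
  inj : Injective _≡_ _≡_ fE′
  inj {zero} {zero} _ = refl
  inj {zero} {suc j} eq = contradiction (sym eq) (E-holds _)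
  inj {suc i} {zero} eq = contradiction eq (E-holds _)
  inj {suc i} {suc j} eq = cong suc (proj₁ I.fE-bij (fE-inj eq))
  sur : ∀ f → Dec (f ≡ e) → ∃[ j ] (∀ {z} → z ≡ j → fE′ z ≡ f)
  sur f (yes refl) = zero , λ { refl → refl }
  sur f (no neq) with E-index neq
  ... | j , eq with proj₂ I.fE-bij j
  ...   | j′ , eq′ = suc j′ , λ { refl → trans (cong fE (eq′ refl)) eq }

collapse : ∀ {n} → Fin n → Fin n → Fin n → Fin n
collapse r o v with v ≟ r
... | yes _ = o
... | no _ = v

collapse-r : ∀ {n} (r o : Fin n) {v} → v ≡ r → collapse r o v ≡ o
collapse-r r o {v} eq with v ≟ r
... | yes _ = refl
... | no neq = contradiction eq neq

collapse-≢ : ∀ {n} (r o : Fin n) {v} → v ≢ r → collapse r o v ≡ v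
collapse-≢ r o {v} neq with v ≟ r
... | yes eq = contradiction eq neq
... | no _ = refl

collapse≢r : ∀ {n} (r o : Fin n) → o ≢ r → ∀ v → collapse r o v ≢ r
collapse≢r r o o≢r v with v ≟ r
... | yes _ = o≢r
... | no v≢r = v≢r

collapse-eq : ∀ {n} (r o : Fin n) {v w} → collapse r o v ≡ collapse r o w → v ≡ w ⊎ (v ≡ r × w ≡ o) ⊎ (v ≡ o × w ≡ r)
collapse-eq r o {v} {w} eq with v ≟ r | w ≟ r
... | yes refl | yes refl = inj₁ refl
... | yes refl | no _ = inj₂ (inj₁ (refl , sym eq))
... | no _ | yes refl = inj₂ (inj₂ (eq , refl))
... | no _ | no _ = inj₁ eq

-- H is G with the edge e removed and its end r merged into its other end o.
record Contraction (H G : Graph) (e : E G) (r o : V G) : Set where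
  field
    fV : V H → V G
    fE : E H → E G
    fV-inj : Injective _≡_ _≡_ fV
    fE-inj : Injective _≡_ _≡_ fE
    fV≢r : ∀ v → fV v ≢ r
    fE≢e : ∀ f → fE f ≢ e
    V-index : ∀ {v} → v ≢ r → ∃[ v′ ] fV v′ ≡ v
    E-index : ∀ {f} → f ≢ e → ∃[ f′ ] fE f′ ≡ f
    src-hom : ∀ f → fV (src H f) ≡ collapse r o (src G (fE f))
    tgt-hom : ∀ f → fV (tgt H f) ≡ collapse r o (tgt G (fE f))
    s-hom : fV (s H) ≡ s G
    t-hom : fV (t H) ≡ t G

contract : ∀ G e {r o} → o ≢ r → s G ≢ r → t G ≢ r → Σ[ H ∈ Graph ] Contraction H G e r o
contract G e {r} {o} o≢r s≢r t≢r = record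
  { nV = RV.size ; nE = RE.size
  ; src = λ f → proj₁ (index (src G (RE.ι f)))
  ; tgt = λ f → proj₁ (index (tgt G (RE.ι f)))
  ; s = proj₁ (RV.index s≢r) ; t = proj₁ (RV.index t≢r) } , record
  { fV = RV.ι ; fE = RE.ι ; fV-inj = RV.injective ; fE-inj = RE.injective
  ; fV≢r = RV.holds ; fE≢e = RE.holds ; V-index = RV.index ; E-index = RE.index
  ; src-hom = λ f → proj₂ (index (src G (RE.ι f)))
  ; tgt-hom = λ f → proj₂ (index (tgt G (RE.ι f)))
  ; s-hom = proj₂ (RV.index s≢r) ; t-hom = proj₂ (RV.index t≢r) }
  where
  module RV = Restriction (restrict (λ v → ¬? (v ≟ r)))
  module RE = Restriction (restrict (λ f → ¬? (f ≟ e)))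
  index : ∀ v → ∃[ i ] RV.ι i ≡ collapse r o v
  index v = RV.index (collapse≢r r o o≢r v)

-- Absorbs the isomorphism at the end of a d-embedding, so that the split can be applied directly to
-- the last graph `K` of the sequence.
contraction-iso : ∀ {K H G e r o} → Iso K H → Contraction H G e r o → Contraction K G e r o
contraction-iso iso c = record
  { fV = fV ∘ I.fV ; fE = fE ∘ I.fE
  ; fV-inj = proj₁ I.fV-bij ∘ fV-inj ; fE-inj = proj₁ I.fE-bij ∘ fE-inj
  ; fV≢r = λ v → fV≢r _ ; fE≢e = λ f → fE≢e _
  ; V-index = λ neq → let w , eq = V-index neq ; w′ , eq′ = proj₂ I.fV-bij w in w′ , trans (cong fV (eq′ refl)) eq
  ; E-index = λ neq → let w , eq = E-index neq ; w′ , eq′ = proj₂ I.fE-bij w in w′ , trans (cong fE (eq′ refl)) eq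
  ; src-hom = λ f → trans (cong fV (sym (I.src-hom f))) (src-hom _)
  ; tgt-hom = λ f → trans (cong fV (sym (I.tgt-hom f))) (tgt-hom _)
  ; s-hom = trans (cong fV I.s-hom) s-hom
  ; t-hom = trans (cong fV I.t-hom) t-hom }
  where
  open Contraction c
  module I = Iso iso

-- The numbering of `fwdSplit` and `bwdSplit`: the new vertex `zero` stands for `r`, the new edge
-- `zero` for `e`.
module Split {H G e r o} (c : Contraction H G e r o) where
  open Contraction c

  fV⁺ : Fin (suc (nV H)) → V G
  fV⁺ zero = r
  fV⁺ (suc v) = fV v

  fE⁺ : Fin (suc (nE H)) → E G
  fE⁺ zero = e
  fE⁺ (suc f) = fE f

  fV⁺-inj : Injective _≡_ _≡_ fV⁺
  fV⁺-inj {zero} {zero} _ = refl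
  fV⁺-inj {zero} {suc j} eq = contradiction (sym eq) (fV≢r _)
  fV⁺-inj {suc i} {zero} eq = contradiction eq (fV≢r _)
  fV⁺-inj {suc i} {suc j} eq = cong suc (fV-inj eq)

  fE⁺-inj : Injective _≡_ _≡_ fE⁺
  fE⁺-inj {zero} {zero} _ = refl
  fE⁺-inj {zero} {suc j} eq = contradiction (sym eq) (fE≢e _)
  fE⁺-inj {suc i} {zero} eq = contradiction eq (fE≢e _)
  fE⁺-inj {suc i} {suc j} eq = cong suc (fE-inj eq)

  fV⁺-sur : ∀ v → ∃[ w ] (∀ {z} → z ≡ w → fV⁺ z ≡ v)
  fV⁺-sur v with v ≟ r
  ... | yes eq = zero , λ { refl → sym eq }
  ... | no neq = let w , eq = V-index neq in suc w , λ { refl → eq }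

  fE⁺-sur : ∀ f → ∃[ g ] (∀ {z} → z ≡ g → fE⁺ z ≡ f)
  fE⁺-sur f with f ≟ e
  ... | yes eq = zero , λ { refl → sym eq }
  ... | no neq = let g , eq = E-index neq in suc g , λ { refl → eq }

-- A forward split of the merged vertex restores `e`, moving the edges that leave `r` in `G`. The
-- new vertex of such a split has one incoming edge, whence the uniqueness of `e`; and `r` has an
-- outgoing edge to move since it is not `t`.
dEmbedded-fsplit : ∀ {H G e} → Flow G → Contraction H G e (tgt G e) (src G e) → (∀ f → tgt G f ≡ tgt G e → f ≡ e) →
                   tgt G e ≢ t G → DEmbedded Braess H → DEmbedded Braess G
dEmbedded-fsplit {H} {G} {e} fl c₀ unique r≢t (K , steps , iso) =
  fwdSplit K a mv , steps ◅◅ (fsplit K a mv a≢t mv-src (proj₁ out , dec-true (src G (fE (proj₁ out)) ≟ r) (proj₂ out)) ◅ ε) , record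
  { fV = fV⁺ ; fE = fE⁺ ; fV-bij = fV⁺-inj , fV⁺-sur ; fE-bij = fE⁺-inj , fE⁺-sur
  ; src-hom = λ { zero → sym fVa ; (suc f) → src⁺ f }
  ; tgt-hom = λ { zero → refl ; (suc f) → sym (trans (tgt-hom f) (collapse-≢ _ _ (fE≢e f ∘ unique _))) }
  ; s-hom = s-hom ; t-hom = t-hom }
  where
  open Flow fl
  c = contraction-iso iso c₀
  open Contraction c
  open Split c
  r o : V G
  r = tgt G e
  o = src G e
  o≢r : o ≢ r
  o≢r eq = acyclic e (subst (Path G r) (sym eq) [])
  a : V K
  a = proj₁ (V-index o≢r)
  fVa : fV a ≡ o
  fVa = proj₂ (V-index o≢r)
  mv : E K → Bool
  mv f = does (src G (fE f) ≟ r)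
  a≢t : a ≢ t K
  a≢t eq = t-sink e (trans (sym fVa) (trans (cong fV eq) t-hom))
  mv-src : ∀ f → mv f ≡ true → src K f ≡ a
  mv-src f eq with src G (fE f) ≟ r
  ... | yes is-r = fV-inj (trans (src-hom f) (trans (collapse-r _ _ is-r) (sym fVa)))
  out : ∃[ f ] src G (fE f) ≡ r
  out with firstEdge (to r) r≢t
  ... | g , i , eq with E-index {g} (λ { refl → o≢r eq })
  ...   | f , refl = f , eq
  src⁺ : ∀ f → src G (fE f) ≡ fV⁺ (if mv f then zero else suc (src K f))
  src⁺ f with src G (fE f) ≟ r
  ... | yes is-r = is-r
  ... | no ≢r = sym (trans (src-hom f) (collapse-≢ _ _ ≢r))

-- The mirror image: `e` is the only edge leaving `r`, and the edges entering `r` are moved.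
dEmbedded-bsplit : ∀ {H G e} → Flow G → Contraction H G e (src G e) (tgt G e) → (∀ f → src G f ≡ src G e → f ≡ e) →
                   src G e ≢ s G → DEmbedded Braess H → DEmbedded Braess G
dEmbedded-bsplit {H} {G} {e} fl c₀ unique r≢s (K , steps , iso) =
  bwdSplit K b mv , steps ◅◅ (bsplit K b mv b≢s mv-tgt (proj₁ inn , dec-true (tgt G (fE (proj₁ inn)) ≟ r) (proj₂ inn)) ◅ ε) , record
  { fV = fV⁺ ; fE = fE⁺ ; fV-bij = fV⁺-inj , fV⁺-sur ; fE-bij = fE⁺-inj , fE⁺-sur
  ; src-hom = λ { zero → refl ; (suc f) → sym (trans (src-hom f) (collapse-≢ _ _ (fE≢e f ∘ unique _))) }
  ; tgt-hom = λ { zero → sym fVb ; (suc f) → tgt⁺ f }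
  ; s-hom = s-hom ; t-hom = t-hom }
  where
  open Flow fl
  c = contraction-iso iso c₀
  open Contraction c
  open Split c
  r o : V G
  r = src G e
  o = tgt G e
  o≢r : o ≢ r
  o≢r eq = acyclic e (subst (Path G o) eq [])
  b : V K
  b = proj₁ (V-index o≢r)
  fVb : fV b ≡ o
  fVb = proj₂ (V-index o≢r)
  mv : E K → Bool
  mv f = does (tgt G (fE f) ≟ r)
  b≢s : b ≢ s K
  b≢s eq = s-source e (trans (sym fVb) (trans (cong fV eq) s-hom))
  mv-tgt : ∀ f → mv f ≡ true → tgt K f ≡ b
  mv-tgt f eq with tgt G (fE f) ≟ r
  ... | yes is-r = fV-inj (trans (tgt-hom f) (trans (collapse-r _ _ is-r) (sym fVb)))
  inn : ∃[ f ] tgt G (fE f) ≡ r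
  inn with lastEdge (from r) (r≢s ∘ sym)
  ... | g , i , eq with E-index {g} (λ { refl → o≢r eq })
  ...   | f , refl = f , eq
  tgt⁺ : ∀ f → tgt G (fE f) ≡ fV⁺ (if mv f then zero else suc (tgt K f))
  tgt⁺ f with tgt G (fE f) ≟ r
  ... | yes is-r = is-r
  ... | no ≢r = sym (trans (tgt-hom f) (collapse-≢ _ _ ≢r))

module Contracted {H G e r o} (fl : Flow G) (c : Contraction H G e r o) (o≢r : o ≢ r) (s≢r : s G ≢ r) (t≢r : t G ≢ r)
  (ends : (src G e ≡ r × tgt G e ≡ o) ⊎ (src G e ≡ o × tgt G e ≡ r)) where
  open Flow fl
  open Contraction c

  size : nE H < nE G
  size = missing⇒< fE-inj e fE≢e

  π : V G → V H
  π v = proj₁ (V-index (collapse≢r r o o≢r v))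

  fV-π : ∀ v → fV (π v) ≡ collapse r o v
  fV-π v = proj₂ (V-index (collapse≢r r o o≢r v))

  π-≢ : ∀ {v w} → v ≢ r → fV w ≡ v → π v ≡ w
  π-≢ {v} v≢r eq = fV-inj (trans (fV-π v) (trans (collapse-≢ r o v≢r) (sym eq)))

  ends-collapse : collapse r o (src G e) ≡ collapse r o (tgt G e)
  ends-collapse = [ (λ (p , q) → trans (collapse-r r o p) (trans (sym q) (sym (collapse-≢ r o (λ eq → o≢r (trans (sym q) eq))))))
                  , (λ (p , q) → trans (collapse-≢ r o (λ eq → o≢r (trans (sym p) eq))) (trans p (sym (collapse-r r o q)))) ]′ ends

  π-eq : ∀ {w} v → fV w ≡ collapse r o v → w ≡ π v
  π-eq v eq = fV-inj (trans eq (sym (fV-π v)))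

  φ-on : ∀ f → Dec (f ≡ e) → Path H (π (src G f)) (π (tgt G f))
  φ-on f (yes refl) = stay (π-eq (tgt G e) (trans (fV-π (src G e)) ends-collapse))
  φ-on f (no neq) with E-index neq
  ... | f′ , refl = edge-on f′ (π-eq (src G f) (src-hom f′)) (π-eq (tgt G f) (tgt-hom f′))

  φ : ∀ f → Path H (π (src G f)) (π (tgt G f))
  φ f = φ-on f (f ≟ e)

  φ-on-R : ∀ f d {y} → y ∈ᵥ φ-on f d → fV y ≡ collapse r o (src G f) ⊎ fV y ≡ collapse r o (tgt G f)
  φ-on-R f (yes refl) i = inj₁ (trans (cong fV (stay-∈ᵥ (π-eq (tgt G e) (trans (fV-π (src G e)) ends-collapse)) i)) (fV-π (src G e)))
  φ-on-R f (no neq) i with E-index neq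
  ... | f′ , refl with edge-on-∈ᵥ {H} f′ (π-eq (src G f) (src-hom f′)) (π-eq (tgt G f) (tgt-hom f′)) i
  ...   | inj₁ eq = inj₁ (trans (cong fV eq) (fV-π (src G f)))
  ...   | inj₂ eq = inj₂ (trans (cong fV eq) (fV-π (tgt G f)))

  φ-R : ∀ f {y} → y ∈ᵥ φ f → fV y ≡ collapse r o (src G f) ⊎ fV y ≡ collapse r o (tgt G f)
  φ-R f = φ-on-R f (f ≟ e)

  -- With `low` and `high`, each edge of the contraction expands to a path of `G` between the
  -- representatives of its ends, so a cycle in `H` would give one in `G`.
  flow′ : (∀ f → f ≢ e → Path G (collapse r o (src G f)) (src G f)) →
          (∀ f → f ≢ e → Path G (tgt G f) (collapse r o (tgt G f))) → Flow H
  flow′ low high = record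
    { acyclic = λ f p → acyclic (fE f) (hi f ⧺ (push p ⧺ lo f))
    ; s≢t = λ eq → s≢t (trans (sym s-hom) (trans (cong fV eq) t-hom))
    ; from = λ v → subst₂ (Path H) (π-≢ s≢r s-hom) (π-≢ (fV≢r v) refl) (mapPath π (from (fV v)) (λ {f} _ → φ f))
    ; to = λ v → subst₂ (Path H) (π-≢ (fV≢r v) refl) (π-≢ t≢r t-hom) (mapPath π (to (fV v)) (λ {f} _ → φ f)) }
    where
    lo : ∀ f → Path G (fV (src H f)) (src G (fE f))
    lo f = subst (λ v → Path G v (src G (fE f))) (sym (src-hom f)) (low (fE f) (fE≢e f))
    hi : ∀ f → Path G (tgt G (fE f)) (fV (tgt H f))
    hi f = subst (Path G (tgt G (fE f))) (sym (tgt-hom f)) (high (fE f) (fE≢e f))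
    push : ∀ {u v} → Path H u v → Path G (fV u) (fV v)
    push p = mapPath fV p λ {f} _ → lo f ⧺ (edge (fE f) ⧺ hi f)

  -- Merging `r` into `o` spoils disjointness only if one of them is on `A` and the other on `B`.
  bad′ : (br : Bad G) → (r ∈ᵥ Bridge.A br → o ∈ᵥ Bridge.B br → ⊥) → (o ∈ᵥ Bridge.A br → r ∈ᵥ Bridge.B br → ⊥) → Bad H
  bad′ br sep sep′ = subst₂ (Bridge H) (π-≢ s≢r s-hom) (π-≢ t≢r t-hom)
    (bridge-map (λ v y → fV y ≡ collapse r o v) π fV-π φ φ-R br λ i j eq eq′ → split i j (collapse-eq r o (trans (sym eq) eq′)))
    where
    open Bridge br
    split : ∀ {v w} → v ∈ᵥ A → w ∈ᵥ B → v ≡ w ⊎ (v ≡ r × w ≡ o) ⊎ (v ≡ o × w ≡ r) → ⊥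
    split i j (inj₁ refl) = disjoint i j
    split i j (inj₂ (inj₁ (refl , refl))) = sep i j
    split i j (inj₂ (inj₂ (refl , refl))) = sep′ i j

-- Irreducible bridges

Unused : ∀ {G} → Bad G → E G → Set
Unused br e = ¬ e ∈ₑ Bridge.A br × ¬ e ∈ₑ Bridge.B br × ¬ e ∈ₑ Bridge.M br

-- No admissible reduction keeps this bridge. The innermost hypotheses describe the sole obstruction
-- to contraction: if `e` is the only edge into its end and this end lies on `A` or `B`, then the
-- start of `e` lies on the same path, unless the end is the first vertex `a` of `B`; dually for
-- `b`.
record Irreducible {G} (br : Bad G) : Set where
  open Bridge br
  field
    ¬delete : ∀ e → Unused br e → ∀ f → tgt G f ≡ tgt G e → f ≢ e → ∀ g → src G g ≡ src G e → g ≢ e → ⊥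
    ¬contract-tgt : ∀ e → (∀ f → tgt G f ≡ tgt G e → f ≡ e) → tgt G e ≢ t G →
                    (tgt G e ≡ a → src G e ∈ᵥ A → ⊥) → ⊥
    ¬contract-src : ∀ e → (∀ f → src G f ≡ src G e → f ≡ e) → src G e ≢ s G →
                    (src G e ≡ b → tgt G e ∈ᵥ B → ⊥) → ⊥

-- If the given path uses `e`, its part up to the end of `e` is rerouted through `f`; acyclicity
-- keeps `e` off both pieces.
deletion-from : ∀ {G} → Flow G → ∀ e f → tgt G f ≡ tgt G e → f ≢ e → ∀ v → Σ[ p ∈ Path G (s G) v ] (∀ {g} → g ∈ₑ p → g ≢ e)
deletion-from {G} fl e f eq f≢e v with Any.any? (e ≟_) (edgesOf (Flow.from fl v))
... | no e∉ = Flow.from fl v , λ { i refl → e∉ i }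
... | yes e∈ = from (src G f) ⧺ (f ∷ (refl , subst (λ w → Path G w v) (sym eq) q)) , avoid
  where
  open Flow fl
  q : Path G (tgt G e) v
  q = after (from v) e∈
  avoid : ∀ {g} → g ∈ₑ (from (src G f) ⧺ (f ∷ (refl , subst (λ w → Path G w v) (sym eq) q))) → g ≢ e
  avoid i refl with ∈ₑ-⧺⁻ (from (src G f)) _ i
  ... | inj₁ j = acyclic f (subst (λ w → Path G w (src G f)) (sym eq) (after (from (src G f)) j))
  ... | inj₂ (here refl) = f≢e refl
  ... | inj₂ (there j) = acyclic e (subst (λ w → Path G w (src G e)) eq (before (subst (λ w → Path G w v) (sym eq) q) j))

deletion-to : ∀ {G} → Flow G → ∀ e f → src G f ≡ src G e → f ≢ e → ∀ v → Σ[ p ∈ Path G v (t G) ] (∀ {g} → g ∈ₑ p → g ≢ e)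
deletion-to {G} fl e f eq f≢e v with Any.any? (e ≟_) (edgesOf (Flow.to fl v))
... | no e∉ = Flow.to fl v , λ { i refl → e∉ i }
... | yes e∈ = before (to v) e∈ ⧺ (f ∷ (eq , to (tgt G f))) , avoid
  where
  open Flow fl
  avoid : ∀ {g} → g ∈ₑ (before (to v) e∈ ⧺ (f ∷ (eq , to (tgt G f)))) → g ≢ e
  avoid i refl with ∈ₑ-⧺⁻ (before (to v) e∈) _ i
  ... | inj₁ j = acyclic e (after (before (to v) e∈) j)
  ... | inj₂ (here refl) = f≢e refl
  ... | inj₂ (there j) = acyclic f (subst (Path G (tgt G f)) (sym eq) (before (to (tgt G f)) j))

-- A reduction that keeps the bridge gives a smaller graph in which the Braess graph is d-embedded
-- up to double negation; undoing the reduction would embed it in `G`.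
irreducible : ∀ {G} → Flow G → ¬ DEmbedded Braess G →
              (∀ H → nE H < nE G → Flow H → Bad H → ¬ ¬ DEmbedded Braess H) → (br : Bad G) → Irreducible br
irreducible {G} fl ¬emb rec br = record { ¬delete = ¬delete ; ¬contract-tgt = ¬contract-tgt ; ¬contract-src = ¬contract-src }
  where
  open Flow fl
  open Bridge br
  ¬delete : ∀ e → Unused br e → ∀ f → tgt G f ≡ tgt G e → f ≢ e → ∀ g → src G g ≡ src G e → g ≢ e → ⊥
  ¬delete e (e∉A , e∉B , e∉M) f f-eq f≢e g g-eq g≢e =
    rec S.H (S.smaller e (λ h → h refl)) flow′ bad′ λ emb → ¬emb (dEmbedded-add S (acyclic e) emb)
    where
    S : Subgraph G (λ _ → ⊤) (_≢ e) (s G) (t G)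
    S = subgraph (λ _ → yes tt) (λ h → ¬? (h ≟ e)) _ _ tt tt
    module S = Subgraph S
    flow′ : Flow S.H
    flow′ = S.subFlow fl s≢t (λ v _ → deletion-from fl e f f-eq f≢e v) (λ v _ → deletion-to fl e g g-eq g≢e v)
    bad′ : Bad S.H
    bad′ = bridge (Lift.path A′) (Lift.path B′)
             (Lift.path (S.liftPath M (λ { i refl → e∉M i }) (proj₂ (S.V-index {a} tt)) (proj₂ (S.V-index {b} tt))))
             (λ i j → disjoint (Lift.along A′ i) (Lift.along B′ j))
      where
      A′ : Lift S.H S.fV A (s S.H) (proj₁ (S.V-index {b} tt))
      A′ = S.liftPath A (λ { i refl → e∉A i }) S.s-hom (proj₂ (S.V-index {b} tt))
      B′ : Lift S.H S.fV B (proj₁ (S.V-index {a} tt)) (t S.H)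
      B′ = S.liftPath B (λ { i refl → e∉B i }) (proj₂ (S.V-index {a} tt)) S.t-hom
  ¬contract-tgt : ∀ e → (∀ f → tgt G f ≡ tgt G e → f ≡ e) → tgt G e ≢ t G →
                  (tgt G e ≡ a → src G e ∈ᵥ A → ⊥) → ⊥
  ¬contract-tgt e unique tgt≢t ok =
    rec H C.size (C.flow′ low high) (C.bad′ br sep sep′) λ emb → ¬emb (dEmbedded-fsplit fl c unique tgt≢t emb)
    where
    r o : V G
    r = tgt G e
    o = src G e
    o≢r : o ≢ r
    o≢r eq = acyclic e (subst (Path G r) (sym eq) [])
    Hc : Σ[ H ∈ Graph ] Contraction H G e r o
    Hc = contract G e o≢r (s-source e ∘ sym) (tgt≢t ∘ sym)
    H : Graph
    H = proj₁ Hc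
    c : Contraction H G e r o
    c = proj₂ Hc
    module C = Contracted fl c o≢r (s-source e ∘ sym) (tgt≢t ∘ sym) (inj₂ (refl , refl))
    low : ∀ f → f ≢ e → Path G (collapse r o (src G f)) (src G f)
    low f f≢e with src G f ≟ r
    ... | yes eq = e ∷ (refl , stay (sym eq))
    ... | no _ = []
    high : ∀ f → f ≢ e → Path G (tgt G f) (collapse r o (tgt G f))
    high f f≢e = stay (sym (collapse-≢ r o (f≢e ∘ unique f)))
    sep : r ∈ᵥ A → o ∈ᵥ B → ⊥
    -- `A` enters `r` along its only incoming edge `e`, so `o` is on `A` as well.
    sep i j with inEdge A i (s-source e ∘ sym)
    ... | f , k , eq with unique f eq
    ...   | refl = disjoint (src∈ A k) j
    sep′ : o ∈ᵥ A → r ∈ᵥ B → ⊥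
    -- Likewise on `B`, except when `B` starts in `r`; this case is left to `ok`.
    sep′ i j with r ≟ a
    ... | yes eq = ok eq i
    ... | no r≢a with inEdge B j (r≢a ∘ sym)
    ...   | f , k , eq with unique f eq
    ...     | refl = disjoint i (src∈ B k)
  ¬contract-src : ∀ e → (∀ f → src G f ≡ src G e → f ≡ e) → src G e ≢ s G →
                  (src G e ≡ b → tgt G e ∈ᵥ B → ⊥) → ⊥
  ¬contract-src e unique src≢s ok =
    rec H C.size (C.flow′ low high) (C.bad′ br sep sep′) λ emb → ¬emb (dEmbedded-bsplit fl c unique src≢s emb)
    where
    r o : V G
    r = src G e
    o = tgt G e
    o≢r : o ≢ r
    o≢r eq = acyclic e (subst (Path G o) eq [])
    Hc : Σ[ H ∈ Graph ] Contraction H G e r o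
    Hc = contract G e o≢r (src≢s ∘ sym) (t-sink e ∘ sym)
    H : Graph
    H = proj₁ Hc
    c : Contraction H G e r o
    c = proj₂ Hc
    module C = Contracted fl c o≢r (src≢s ∘ sym) (t-sink e ∘ sym) (inj₁ (refl , refl))
    low : ∀ f → f ≢ e → Path G (collapse r o (src G f)) (src G f)
    low f f≢e = stay (collapse-≢ r o (f≢e ∘ unique f))
    high : ∀ f → f ≢ e → Path G (tgt G f) (collapse r o (tgt G f))
    high f f≢e with tgt G f ≟ r
    ... | yes eq = e ∷ (sym eq , [])
    ... | no _ = []
    sep : r ∈ᵥ A → o ∈ᵥ B → ⊥
    sep i j with r ≟ b
    ... | yes eq = ok eq j
    ... | no r≢b with outEdge A i r≢b
    ...   | f , k , eq with unique f eq
    ...     | refl = disjoint (tgt∈ A k) j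
    sep′ : o ∈ᵥ A → r ∈ᵥ B → ⊥
    sep′ i j with outEdge B j (t-sink e)
    ... | f , k , eq with unique f eq
    ...   | refl = disjoint i (tgt∈ B k)

otherIn : ∀ {G} e → (∃[ f ] tgt G f ≡ tgt G e × f ≢ e) ⊎ (∀ f → tgt G f ≡ tgt G e → f ≡ e)
otherIn {G} e with any? (λ f → (tgt G f ≟ tgt G e) ×-dec ¬? (f ≟ e))
... | yes h = inj₁ h
... | no none = inj₂ λ f eq → decidable-stable (f ≟ e) λ neq → none (f , eq , neq)

otherOut : ∀ {G} e → (∃[ f ] src G f ≡ src G e × f ≢ e) ⊎ (∀ f → src G f ≡ src G e → f ≡ e)
otherOut {G} e with any? (λ f → (src G f ≟ src G e) ×-dec ¬? (f ≟ e))
... | yes h = inj₁ h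
... | no none = inj₂ λ f eq → decidable-stable (f ≟ e) λ neq → none (f , eq , neq)

bridge-s≢b : ∀ {G} → Flow G → (br : Bad G) → s G ≢ Bridge.b br
bridge-s≢b fl (bridge A B M dis) refl with source-path (Flow.s-source fl) M
... | eq = dis (start∈ A) (subst (_∈ᵥ B) eq (start∈ B))

bridge-a≢t : ∀ {G} → Flow G → (br : Bad G) → Bridge.a br ≢ t G
bridge-a≢t fl (bridge A B M dis) refl with sink-path (Flow.t-sink fl) M
... | eq = dis (end∈ A) (subst (_∈ᵥ B) eq (end∈ B))

-- If another edge leaves the start of `f`, then `f` can be deleted. Otherwise `f` can be
-- contracted: its end is off `B`, and its start is not `s`, since the first edge of `A` is not `f`.
unused-in⇒⊥ : ∀ {G} → Flow G → (br : Bad G) → Irreducible br → ∀ f → Unused br f → ¬ tgt G f ∈ᵥ Bridge.B br →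
              ∀ g → tgt G g ≡ tgt G f → g ≢ f → ⊥
unused-in⇒⊥ {G} fl br irr f un f∉B g eq g≢f with otherOut {G} f
... | inj₁ (h , eq′ , h≢f) = Irreducible.¬delete irr f un g eq g≢f h eq′ h≢f
... | inj₂ unique = Irreducible.¬contract-src irr f unique src≢s λ _ → f∉B
  where
  src≢s : src G f ≢ s G
  src≢s is-s with outEdge (Bridge.A br) (start∈ (Bridge.A br)) (bridge-s≢b fl br)
  ... | h , i , eq′ with unique h (trans eq′ (sym is-s))
  ...   | refl = proj₁ un i

unused-out⇒⊥ : ∀ {G} → Flow G → (br : Bad G) → Irreducible br → ∀ f → Unused br f → ¬ src G f ∈ᵥ Bridge.A br →
               ∀ g → src G g ≡ src G f → g ≢ f → ⊥
unused-out⇒⊥ {G} fl br irr f un f∉A g eq g≢f with otherIn {G} f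
... | inj₁ (h , eq′ , h≢f) = Irreducible.¬delete irr f un h eq′ h≢f g eq g≢f
... | inj₂ unique = Irreducible.¬contract-tgt irr f unique tgt≢t λ _ → f∉A
  where
  tgt≢t : tgt G f ≢ t G
  tgt≢t is-t with inEdge (Bridge.B br) (end∈ (Bridge.B br)) (bridge-a≢t fl br)
  ... | h , i , eq′ with unique h (trans eq′ (sym is-t))
  ...   | refl = proj₁ (proj₂ un) i

-- Recognition of the Braess graph

path-tgt-inj : ∀ {G u v e f} → Flow G → (p : Path G u v) → e ∈ₑ p → f ∈ₑ p → tgt G e ≡ tgt G f → e ≡ f
path-tgt-inj {G} {e = e} {f} fl p i j eq = decidable-stable (e ≟ f) λ neq →
  [ (λ q → Flow.acyclic fl f (subst (λ v → Path G v (src G f)) eq q))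
  , (λ q → Flow.acyclic fl e (subst (λ v → Path G v (src G e)) (sym eq) q)) ]′ (serial-order p i j neq)

path-src-inj : ∀ {G u v e f} → Flow G → (p : Path G u v) → e ∈ₑ p → f ∈ₑ p → src G e ≡ src G f → e ≡ f
path-src-inj {G} {e = e} {f} fl p i j eq = decidable-stable (e ≟ f) λ neq →
  [ (λ q → Flow.acyclic fl e (subst (Path G (tgt G e)) (sym eq) q))
  , (λ q → Flow.acyclic fl f (subst (Path G (tgt G f)) eq q)) ]′ (serial-order p i j neq)

_∈ₑ?_ : ∀ {G u v} e (p : Path G u v) → Dec (e ∈ₑ p)
e ∈ₑ? p = Any.any? (e ≟_) (edgesOf p)

_∈ᵥ?_ : ∀ {G u v} x (p : Path G u v) → Dec (x ∈ᵥ p)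
x ∈ᵥ? p = Any.any? (x ≟_) (verticesOf p)

-- The Braess graph has no parallel edges, so injectivity on edges reduces to injectivity on
-- vertices.
braess-edges : ∀ i j → braessSrc i ≡ braessSrc j → braessTgt i ≡ braessTgt j → i ≡ j
braess-edges = toWitness {a? = all? λ i → all? λ j →
  (braessSrc i ≟ braessSrc j) →-dec ((braessTgt i ≟ braessTgt j) →-dec (i ≟ j))} _

pattern #0 = zero
pattern #1 = suc zero
pattern #2 = suc (suc zero)
pattern #3 = suc (suc (suc zero))
pattern #4 = suc (suc (suc (suc zero)))

-- That the four vertices are distinct and exhaust `G` follows in `frame-iso`: acyclicity separates
-- them, and every vertex other than `s` is the end of one of the five edges.
record BraessFrame (G : Graph) : Set where
  field
    a b : V G
    sa sb ab at bt : E G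
    src-sa : src G sa ≡ s G
    tgt-sa : tgt G sa ≡ a
    src-sb : src G sb ≡ s G
    tgt-sb : tgt G sb ≡ b
    src-ab : src G ab ≡ a
    tgt-ab : tgt G ab ≡ b
    src-at : src G at ≡ a
    tgt-at : tgt G at ≡ t G
    src-bt : src G bt ≡ b
    tgt-bt : tgt G bt ≡ t G
    exhaustive : ∀ e → e ≡ sa ⊎ e ≡ sb ⊎ e ≡ ab ⊎ e ≡ at ⊎ e ≡ bt

frame-iso : ∀ {G} → Flow G → BraessFrame G → Iso Braess G
frame-iso {G} fl fr = record
  { fV = fV ; fE = fE ; fV-bij = fV-inj , fV-sur ; fE-bij = fE-inj , fE-sur
  ; src-hom = src-hom ; tgt-hom = tgt-hom ; s-hom = refl ; t-hom = refl }
  where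
  open Flow fl
  open BraessFrame fr
  s≢ : ∀ e {v} → tgt G e ≡ v → s G ≢ v
  s≢ e eq eq′ = s-source e (trans eq (sym eq′))
  ≢t : ∀ e {v} → src G e ≡ v → v ≢ t G
  ≢t e eq eq′ = t-sink e (trans eq eq′)
  a≢b : a ≢ b
  a≢b eq = acyclic ab (stay (trans tgt-ab (sym (trans src-ab eq))))
  fV : V Braess → V G
  fV #0 = s G
  fV #1 = a
  fV #2 = b
  fV #3 = t G
  fE : E Braess → E G
  fE #0 = sa
  fE #1 = sb
  fE #2 = ab
  fE #3 = at
  fE #4 = bt
  src-hom : ∀ e → src G (fE e) ≡ fV (braessSrc e)
  src-hom #0 = src-sa
  src-hom #1 = src-sb
  src-hom #2 = src-ab
  src-hom #3 = src-at
  src-hom #4 = src-bt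
  tgt-hom : ∀ e → tgt G (fE e) ≡ fV (braessTgt e)
  tgt-hom #0 = tgt-sa
  tgt-hom #1 = tgt-sb
  tgt-hom #2 = tgt-ab
  tgt-hom #3 = tgt-at
  tgt-hom #4 = tgt-bt
  fV-inj : Injective _≡_ _≡_ fV
  fV-inj {#0} {#0} _ = refl
  fV-inj {#0} {#1} eq = contradiction eq (s≢ sa tgt-sa)
  fV-inj {#0} {#2} eq = contradiction eq (s≢ sb tgt-sb)
  fV-inj {#0} {#3} eq = contradiction eq s≢t
  fV-inj {#1} {#0} eq = contradiction (sym eq) (s≢ sa tgt-sa)
  fV-inj {#1} {#1} _ = refl
  fV-inj {#1} {#2} eq = contradiction eq a≢b
  fV-inj {#1} {#3} eq = contradiction eq (≢t at src-at)
  fV-inj {#2} {#0} eq = contradiction (sym eq) (s≢ sb tgt-sb)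
  fV-inj {#2} {#1} eq = contradiction (sym eq) a≢b
  fV-inj {#2} {#2} _ = refl
  fV-inj {#2} {#3} eq = contradiction eq (≢t bt src-bt)
  fV-inj {#3} {#0} eq = contradiction (sym eq) s≢t
  fV-inj {#3} {#1} eq = contradiction (sym eq) (≢t at src-at)
  fV-inj {#3} {#2} eq = contradiction (sym eq) (≢t bt src-bt)
  fV-inj {#3} {#3} _ = refl
  fE-inj : Injective _≡_ _≡_ fE
  fE-inj {i} {j} eq = braess-edges i j
    (fV-inj (trans (sym (src-hom i)) (trans (cong (src G) eq) (src-hom j))))
    (fV-inj (trans (sym (tgt-hom i)) (trans (cong (tgt G) eq) (tgt-hom j))))
  fE-sur : ∀ e → ∃[ i ] (∀ {z} → z ≡ i → fE z ≡ e)
  fE-sur e with exhaustive e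
  ... | inj₁ eq = #0 , λ { refl → sym eq }
  ... | inj₂ (inj₁ eq) = #1 , λ { refl → sym eq }
  ... | inj₂ (inj₂ (inj₁ eq)) = #2 , λ { refl → sym eq }
  ... | inj₂ (inj₂ (inj₂ (inj₁ eq))) = #3 , λ { refl → sym eq }
  ... | inj₂ (inj₂ (inj₂ (inj₂ eq))) = #4 , λ { refl → sym eq }
  fV-sur : ∀ v → ∃[ i ] (∀ {z} → z ≡ i → fV z ≡ v)
  fV-sur v with v ≟ s G
  ... | yes eq = #0 , λ { refl → sym eq }
  ... | no neq with lastEdge (from v) (neq ∘ sym)
  ...   | f , _ , eq with fE-sur f
  ...     | i , h = braessTgt i , λ { refl → trans (sym (tgt-hom i)) (trans (cong (tgt G) (h refl)) eq) }

single-edge-frame : ∀ {G} → Flow G → ∀ ab (A : Path G (s G) (tgt G ab)) (B : Path G (src G ab) (t G))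
                    (dis : ∀ {v} → v ∈ᵥ A → v ∈ᵥ B → ⊥) → Irreducible (bridge A B (edge ab) dis) → BraessFrame G
single-edge-frame {G} fl ab A B dis irr = record
  { a = a ; b = b ; sa = sa ; sb = sb ; ab = ab ; at = at ; bt = bt
  ; src-sa = src-sa ; tgt-sa = tgt-sa ; src-sb = src-sb ; tgt-sb = A⇒b sb∈A ; src-ab = refl ; tgt-ab = refl
  ; src-at = B⇒a at∈B ; tgt-at = tgt-at ; src-bt = src-bt ; tgt-bt = tgt-bt ; exhaustive = exhaustive }
  where
  open Flow fl
  open Irreducible irr
  br : Bad G
  br = bridge A B (edge ab) dis
  a b : V G
  a = src G ab
  b = tgt G ab
  unused : ∀ {f} → ¬ f ∈ₑ A → ¬ f ∈ₑ B → f ≢ ab → Unused br f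
  unused f∉A f∉B f≢ab = f∉A , f∉B , λ { (here refl) → f≢ab refl }
  A⇒b : ∀ {g} → g ∈ₑ A → tgt G g ≡ b
  A⇒b {g} i = decidable-stable (tgt G g ≟ b) λ ≢b →
    ¬contract-tgt g (unique ≢b) (λ eq → dis (tgt∈ A i) (subst (_∈ᵥ B) (sym eq) (end∈ B)))
      (λ eq _ → dis (tgt∈ A i) (subst (_∈ᵥ B) (sym eq) (start∈ B)))
    where
    unique : tgt G g ≢ b → ∀ f → tgt G f ≡ tgt G g → f ≡ g
    unique ≢b f eq with f ∈ₑ? A | f ∈ₑ? B | f ≟ ab
    ... | yes j | _ | _ = path-tgt-inj fl A j i eq
    ... | no _ | yes j | _ = ⊥-elim (dis (tgt∈ A i) (subst (_∈ᵥ B) eq (tgt∈ B j)))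
    ... | no _ | no _ | yes refl = contradiction (sym eq) ≢b
    ... | no f∉A | no f∉B | no f≢ab = ⊥-elim
      (unused-in⇒⊥ fl br irr f (unused f∉A f∉B f≢ab) (λ k → dis (tgt∈ A i) (subst (_∈ᵥ B) eq k)) g (sym eq) λ { refl → f∉A i })
  B⇒a : ∀ {h} → h ∈ₑ B → src G h ≡ a
  B⇒a {h} i = decidable-stable (src G h ≟ a) λ ≢a →
    ¬contract-src h (unique ≢a) (λ eq → dis (subst (_∈ᵥ A) (sym eq) (start∈ A)) (src∈ B i))
      (λ eq _ → dis (subst (_∈ᵥ A) (sym eq) (end∈ A)) (src∈ B i))
    where
    unique : src G h ≢ a → ∀ f → src G f ≡ src G h → f ≡ h
    unique ≢a f eq with f ∈ₑ? B | f ∈ₑ? A | f ≟ ab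
    ... | yes j | _ | _ = path-src-inj fl B j i eq
    ... | no _ | yes j | _ = ⊥-elim (dis (subst (_∈ᵥ A) eq (src∈ A j)) (src∈ B i))
    ... | no _ | no _ | yes refl = contradiction (sym eq) ≢a
    ... | no f∉B | no f∉A | no f≢ab = ⊥-elim
      (unused-out⇒⊥ fl br irr f (unused f∉A f∉B f≢ab) (λ k → dis (subst (_∈ᵥ A) eq k) (src∈ B i)) h (sym eq) λ { refl → f∉B i })
  sb-edge : Σ[ e ∈ E G ] e ∈ₑ A × src G e ≡ s G
  sb-edge = firstEdge A (bridge-s≢b fl br)
  sb : E G
  sb = proj₁ sb-edge
  sb∈A : sb ∈ₑ A
  sb∈A = proj₁ (proj₂ sb-edge)
  src-sb : src G sb ≡ s G
  src-sb = proj₂ (proj₂ sb-edge)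
  at-edge : Σ[ e ∈ E G ] e ∈ₑ B × tgt G e ≡ t G
  at-edge = lastEdge B (bridge-a≢t fl br)
  at : E G
  at = proj₁ at-edge
  at∈B : at ∈ₑ B
  at∈B = proj₁ (proj₂ at-edge)
  tgt-at : tgt G at ≡ t G
  tgt-at = proj₂ (proj₂ at-edge)
  A⇒sb : ∀ {f} → f ∈ₑ A → f ≡ sb
  A⇒sb i = path-tgt-inj fl A i sb∈A (trans (A⇒b i) (sym (A⇒b sb∈A)))
  B⇒at : ∀ {f} → f ∈ₑ B → f ≡ at
  B⇒at i = path-src-inj fl B i at∈B (trans (B⇒a i) (sym (B⇒a at∈B)))
  ∈A⇒ : ∀ {v} → v ∈ᵥ A → v ≢ b → v ≡ s G
  ∈A⇒ i v≢b with outEdge A i v≢b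
  ... | f , j , eq = trans (sym eq) (trans (cong (src G) (A⇒sb j)) src-sb)
  ∈B⇒ : ∀ {v} → v ∈ᵥ B → v ≢ a → v ≡ t G
  ∈B⇒ i v≢a with inEdge B i (v≢a ∘ sym)
  ... | f , j , eq = trans (sym eq) (trans (cong (tgt G) (B⇒at j)) tgt-at)
  ¬b→a : ∀ f → src G f ≡ b → tgt G f ≢ a
  ¬b→a f p q = acyclic ab (f ∷ (p , stay q))
  classify : ∀ f → Unused br f → (src G f ≡ s G × tgt G f ≡ a) ⊎ (src G f ≡ b × tgt G f ≡ t G)
  -- As `f` cannot be deleted, it lacks a companion at its start or at its end. Then only the
  -- obstruction to contraction is left: `f` runs from `b` to `B`, or from `A` to `a`, and
  -- acyclicity rules out an edge from `b` to `a`.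
  classify f un with otherOut {G} f | otherIn {G} f
  ... | inj₁ (g , g-eq , g≢f) | inj₁ (h , h-eq , h≢f) = ⊥-elim (¬delete f un h h-eq h≢f g g-eq g≢f)
  ... | inj₂ unique | _ with (src G f ≟ b) ×-dec (tgt G f ∈ᵥ? B)
  ...   | yes (is-b , in-B) = inj₂ (is-b , ∈B⇒ in-B (¬b→a f is-b))
  ...   | no nope = ⊥-elim (¬contract-src f unique
            (λ is-s → proj₁ un (subst (_∈ₑ A) (unique sb (trans src-sb (sym is-s))) sb∈A)) (λ p q → nope (p , q)))
  classify f un | inj₁ _ | inj₂ unique with (tgt G f ≟ a) ×-dec (src G f ∈ᵥ? A)
  ...   | yes (is-a , in-A) = inj₁ (∈A⇒ in-A (λ is-b → ¬b→a f is-b is-a) , is-a)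
  ...   | no nope = ⊥-elim (¬contract-tgt f unique
            (λ is-t → proj₁ (proj₂ un) (subst (_∈ₑ B) (unique at (trans tgt-at (sym is-t))) at∈B)) (λ p q → nope (p , q)))
  s≢a : s G ≢ a
  s≢a eq = dis (start∈ A) (subst (_∈ᵥ B) (sym eq) (start∈ B))
  b≢t : b ≢ t G
  b≢t eq = dis (end∈ A) (subst (_∈ᵥ B) (sym eq) (end∈ B))
  a≢b : a ≢ b
  a≢b eq = acyclic ab (stay (sym eq))
  sa-edge : Σ[ e ∈ E G ] e ∈ₑ from a × tgt G e ≡ a
  sa-edge = lastEdge (from a) s≢a
  sa : E G
  sa = proj₁ sa-edge
  tgt-sa : tgt G sa ≡ a
  tgt-sa = proj₂ (proj₂ sa-edge)
  sa-unused : Unused br sa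
  sa-unused = unused (λ i → a≢b (trans (sym tgt-sa) (A⇒b i)))
                     (λ i → acyclic sa (stay (trans tgt-sa (sym (B⇒a i)))))
                     (λ eq → a≢b (trans (sym tgt-sa) (cong (tgt G) eq)))
  src-sa : src G sa ≡ s G
  src-sa with classify sa sa-unused
  ... | inj₁ (p , _) = p
  ... | inj₂ (_ , q) = contradiction (trans (sym tgt-sa) q) (bridge-a≢t fl br)
  bt-edge : Σ[ e ∈ E G ] e ∈ₑ to b × src G e ≡ b
  bt-edge = firstEdge (to b) b≢t
  bt : E G
  bt = proj₁ bt-edge
  src-bt : src G bt ≡ b
  src-bt = proj₂ (proj₂ bt-edge)
  bt-unused : Unused br bt
  bt-unused = unused (λ i → acyclic bt (stay (trans (A⇒b i) (sym src-bt))))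
                     (λ i → a≢b (trans (sym (B⇒a i)) src-bt))
                     (λ eq → a≢b (trans (sym (cong (src G) eq)) src-bt))
  tgt-bt : tgt G bt ≡ t G
  tgt-bt with classify bt bt-unused
  ... | inj₁ (p , _) = contradiction (trans (sym p) src-bt) (bridge-s≢b fl br)
  ... | inj₂ (_ , q) = q
  exhaustive : ∀ f → f ≡ sa ⊎ f ≡ sb ⊎ f ≡ ab ⊎ f ≡ at ⊎ f ≡ bt
  exhaustive f with f ∈ₑ? A | f ∈ₑ? B | f ≟ ab
  ... | yes i | _ | _ = inj₂ (inj₁ (A⇒sb i))
  ... | no _ | yes i | _ = inj₂ (inj₂ (inj₂ (inj₁ (B⇒at i))))
  ... | no _ | no _ | yes eq = inj₂ (inj₂ (inj₁ eq))
  ... | no f∉A | no f∉B | no f≢ab with classify f (unused f∉A f∉B f≢ab)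
  -- A second edge from `s` to `a` could be deleted, with `sa` as companion at `a` and `sb` at `s`.
  ...   | inj₁ (p , q) = inj₁ (decidable-stable (f ≟ sa) λ f≢sa →
            ¬delete f (unused f∉A f∉B f≢ab) sa (trans tgt-sa (sym q)) (f≢sa ∘ sym) sb (trans src-sb (sym p)) λ { refl → f∉A sb∈A })
  ...   | inj₂ (p , q) = inj₂ (inj₂ (inj₂ (inj₂ (decidable-stable (f ≟ bt) λ f≢bt →
            ¬delete f (unused f∉A f∉B f≢ab) at (trans tgt-at (sym q)) (λ { refl → f∉B at∈B }) bt (trans src-bt (sym p)) (f≢bt ∘ sym)))))

-- The first edge of M is contractible unless its target lies on A or B; in
-- these cases M can be shortened.
irreducible-frame : ∀ {G} → Flow G → (∀ br → Irreducible {G} br) → Bad G → BraessFrame G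
irreducible-frame {G} fl irr (bridge A B M dis) = go A B M dis
  where
  open Flow fl
  go : ∀ {a b} (A : Path G (s G) b) (B : Path G a (t G)) (M : Path G a b) →
       (∀ {v} → v ∈ᵥ A → v ∈ᵥ B → ⊥) → BraessFrame G
  go A B [] dis = ⊥-elim (dis (end∈ A) (start∈ B))
  go A B M@(e ∷ (refl , M′)) dis with tgt G e ∈ᵥ? A | tgt G e ∈ᵥ? B
  -- The end of `e` becomes the new `b`, with `A` cut there; in the next case it becomes the new
  -- `a`, with `B` cut there. The bridge changes, which is why irreducibility is assumed for all
  -- bridges.
  ... | yes i | _ = let A′ , A′⊆A , _ = prefix A i in
                    single-edge-frame fl e A′ B (dis ∘ A′⊆A) (irr _)
  ... | no _ | yes j = let B′ , B′⊆B , _ = suffix B j in go A B′ M′ (λ i k → dis i (B′⊆B k))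
  ... | no ∉A | no ∉B = ⊥-elim (Irreducible.¬contract-tgt (irr br) e unique
          (λ eq → ∉B (subst (_∈ᵥ B) (sym eq) (end∈ B))) (λ eq _ → ∉B (subst (_∈ᵥ B) (sym eq) (start∈ B))))
    where
    br : Bad G
    br = bridge A B M dis
    unique : ∀ f → tgt G f ≡ tgt G e → f ≡ e
    unique f eq = decidable-stable (f ≟ e) λ f≢e → unused-in⇒⊥ fl br (irr br) f
      ((λ i → ∉A (subst (_∈ᵥ A) eq (tgt∈ A i))) , (λ i → ∉B (subst (_∈ᵥ B) eq (tgt∈ B i))) ,
       (λ i → f≢e (path-tgt-inj fl M i (here refl) eq)))
      (λ k → ∉B (subst (_∈ᵥ B) eq k)) e (sym eq) (f≢e ∘ sym)

-- If the Braess graph were not d-embedded, every bridge of `G` would be irreducible and `G` itself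
-- a Braess graph, d-embedded by the empty sequence.
bad⇒¬¬dEmbedded : ∀ {G} → Flow G → Bad G → ¬ ¬ DEmbedded Braess G
bad⇒¬¬dEmbedded {G} = go G (<-wellFounded (nE G))
  where
  go : ∀ G → Acc _<_ (nE G) → Flow G → Bad G → ¬ ¬ DEmbedded Braess G
  go G (acc rec) fl br ¬emb = ¬emb (Braess , ε , frame-iso fl (irreducible-frame fl irr br))
    where
    irr : ∀ br → Irreducible br
    irr = irreducible fl ¬emb λ H lt → go H (rec lt)

theorem27 : (G : Graph) → TDAG G →
    (IsSP G ⇔ (¬ DEmbedded Braess G)) × ((¬ DEmbedded Braess G) ⇔ SPW≡ G 1)
theorem27 G tdag =
  mk⇔ (λ sp → sp-¬bad sp ∘ dEmbedded-bad) (¬bad-sp fl ∘ ¬emb⇒¬bad) ,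
  mk⇔ (SPW≡1 fl ∘ ¬emb⇒¬bad) (λ spw emb → bad⇒SPW≢1 fl (dEmbedded-bad emb) spw)
  where
  fl : Flow G
  fl = flow tdag
  ¬emb⇒¬bad : ¬ DEmbedded Braess G → ¬ Bad G
  ¬emb⇒¬bad ¬emb br = bad⇒¬¬dEmbedded fl br ¬emb
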